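{- Fix an integer $t\ge 3$. Then $\mathrm{ex}(n,K_{t,t},K_{2,t+1})=\Theta_t(n^2)$; that is, there are constants $c_t,C_t>0$ depending only on $t$ such that for all sufficiently large $n$, \[ c_t n^2\le \mathrm{ex}(n,K_{t,t},K_{2,t+1})\le C_t n^2. \] In particular, there exists a constant $c_t>0$ such that for every sufficiently large integer $n$ there is a $K_{2,t+1}$-free graph on $n$ vertices containing at least $c_t n^2$ copies of $K_{t,t}$.
   Context: For graphs $H$ and $F$, $\mathrm{ex}(n,H,F)$ denotes the maximum number of copies of $H$ (subgraphs isomorphic to $H$) in an $n$-vertex graph that contains no copy of $F$ as a subgraph. $K_{a,b}$ denotes the complete bipartite graph with parts of sizes $a$ and $b$. The notation $\Theta_t$ means the implied constants may depend on $t$. -}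

module Defs where

open import Data.Nat using (ℕ; zero; suc; _/_)
import Data.Nat as ℕ
open import Data.Bool using (Bool; true; false)
import Data.Bool.Properties as BoolP
open import Data.Fin using (Fin)
open import Data.Fin.Properties using (all?)
open import Data.Fin.Subset using (Subset; _∈_; _∉_; ∣_∣)
open import Data.Fin.Subset.Properties using (_∈?_)
open import Data.Vec using ([]; _∷_)
open import Data.List using (List; []; _∷_; concatMap; cartesianProduct; filter; length)
open import Data.Product using (Σ; _×_; _,_; proj₁; proj₂)
open import Relation.Nullary using (¬_; Dec)
open import Relation.Nullary.Decidable using (¬?; _×-dec_; _→-dec_)
open import Relation.Binary.PropositionalEquality using (_≡_)

record Graph (n : ℕ) : Set where
  field
    adj    : Fin n → Fin n → Bool
    sym    : ∀ i j → adj i j ≡ adj j i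
    irrefl : ∀ i → adj i i ≡ false
open Graph public

Disjoint : ∀ {n} → Subset n → Subset n → Set
Disjoint A B = ∀ i → i ∈ A → ¬ (i ∈ B)

Complete : ∀ {n} → Graph n → Subset n → Subset n → Set
Complete G A B = ∀ i j → i ∈ A → j ∈ B → adj G i j ≡ true

IsKab : ∀ {n} → ℕ → ℕ → Graph n → Subset n → Subset n → Set
IsKab a b G A B = (∣ A ∣ ≡ a) × (∣ B ∣ ≡ b) × Disjoint A B × Complete G A B

ContainsKab : ∀ {n} → ℕ → ℕ → Graph n → Set
ContainsKab a b G = Σ _ λ A → Σ _ λ B → IsKab a b G A B

KabFree : ∀ {n} → ℕ → ℕ → Graph n → Set
KabFree a b G = ¬ ContainsKab a b G

disjoint? : ∀ {n} (A B : Subset n) → Dec (Disjoint A B)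
disjoint? A B = all? λ i → (i ∈? A) →-dec ¬? (i ∈? B)

complete? : ∀ {n} (G : Graph n) (A B : Subset n) → Dec (Complete G A B)
complete? G A B = all? λ i → all? λ j →
  (i ∈? A) →-dec ((j ∈? B) →-dec (adj G i j BoolP.≟ true))

isKab? : ∀ {n} a b (G : Graph n) (p : Subset n × Subset n) → Dec (IsKab a b G (proj₁ p) (proj₂ p))
isKab? a b G (A , B) =
  (∣ A ∣ ℕ.≟ a) ×-dec ((∣ B ∣ ℕ.≟ b) ×-dec (disjoint? A B ×-dec complete? G A B))

allSubsets : (n : ℕ) → List (Subset n)
allSubsets zero = [] ∷ []
allSubsets (suc n) = concatMap (λ s → (true ∷ s) ∷ (false ∷ s) ∷ []) (allSubsets n)

orderedKtt : ∀ {n} → ℕ → Graph n → ℕ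
orderedKtt {n} t G = length (filter (isKab? t t G) (cartesianProduct (allSubsets n) (allSubsets n)))

-- Number of copies (subgraphs isomorphic to) K_{t,t} in G, for t ≥ 1:
-- each copy is determined by its unordered bipartition {A , B}, hence
-- corresponds to exactly two ordered pairs.
copiesKtt : ∀ {n} → ℕ → Graph n → ℕ
copiesKtt t G = orderedKtt t G / 2

{-# OPTIONS --safe #-}
module Submission where

-- Upper bound: in a K_{2,t+1}-free graph two vertices of A determine B in a copy (A , B) of
-- K_{t,t}, and two vertices of B then determine A.
--
-- Lower bound: let p be a prime with p² ≤ n = O(p²), and cut [0 , tD) ⊆ [0 , p) into t intervals of
-- length D. The vertices are the points (x , y) with x < tD and y < p; the index τ of the
-- interval of x is the type of the point. For a fixed residue e, join (x , y) to (a , b) when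
--   x a ≡ y + b + τ(x) τ(a) e  (mod p).
-- Two vertices have at most one common neighbour of each type, hence at most t in total. If
-- δ ε ≡ e, expanding (x + iδ)(a + jε) shows that the points
--   (x + iδ , xa + iδa + κ)  and  (a + jε , jεx - κ)  for i , j < t
-- form a K_{t,t} as soon as x + iδ and a + jε have types i and j. With δ and ε taken from
-- intervals of length proportional to p, the most popular e = δ ε gives of the order of p⁴ such copies.
--
-- The primes come from a weak form of Bertrand's postulate: every common multiple of 1 , … , 2m + 1
-- is at least 2^m.

open import Defs hiding (sym)
open import Level using (Level)
open import Data.Bool using (true; false)
open import Data.Nat using (ℕ; zero; suc; _+_; _*_; _^_; _≤_; _<_; _≥_; z≤n; s≤s; s≤s⁻¹; _/_; _%_; _!; NonZero; >-nonZero; >-nonZero⁻¹; nonTrivial⇒n>1)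
open import Data.Nat.Properties
open import Data.Nat.Divisibility
open import Data.Nat.DivMod
open import Data.Nat.ListAction using (product)
open import Data.Nat.Primality
open import Data.Nat.Primality.Factorisation using (factorise; PrimeFactorisation)
open import Data.Nat.Tactic.RingSolver using (solve-∀)
open import Data.Integer as ℤ using (ℤ; +_)
import Data.Integer.DivMod as ℤ
import Data.Integer.Properties as ℤ
open import Data.Integer.Divisibility.Signed as ℤ∣ using (∣⇒∣ᵤ; ∣ᵤ⇒∣)
import Data.Integer.Tactic.RingSolver as ℤ-Ring
open import Data.Fin as Fin using (Fin; zero; suc; toℕ; fromℕ<; combine; remQuot; inject≤)
open import Data.Fin.Properties as Fin using (toℕ<n; toℕ-injective; toℕ-fromℕ<; combine-injective; injective⇒≤; pigeonhole)
open import Data.Fin.Subset using (Subset; _∈_; _∉_; _⊆_; ∣_∣; ⊥; ⁅_⁆; _∪_)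
open import Data.Fin.Subset.Properties
open import Data.Vec using ([]; _∷_; here; there)
open import Data.List using (List; []; _∷_; length; lookup; filter; concatMap; cartesianProduct; allFin)
import Data.List.Membership.Propositional as List
open import Data.List.Membership.Propositional.Properties using (∈-lookup; ∈-filter⁺; ∈-filter⁻; ∈-cartesianProduct⁺; ∈-allFin)
open import Data.List.Membership.Setoid.Properties using (index-injective)
open import Data.List.Relation.Unary.All as All using (All; []; _∷_)
open import Data.List.Relation.Unary.AllPairs using ([]; _∷_)
import Data.List.Relation.Unary.Any as Any
open import Data.List.Relation.Unary.Unique.Propositional using (Unique)
import Data.List.Relation.Unary.Unique.Propositional.Properties as Unique
open import Data.Product using (Σ; ∃; _×_; _,_; proj₁; proj₂)
open import Data.Product.Function.NonDependent.Propositional using (_×-↔_)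
open import Data.Sum as Sum using (_⊎_; inj₁; inj₂; [_,_]′)
open import Function using (_∘_; mk⇔; _↔_; Inverse; Injection)
open import Function.Definitions using (Injective)
open import Function.Properties.Inverse using (↔-refl; ↔-trans; ↔⇒↣)
open import Relation.Nullary using (¬_; Dec; yes; no; contradiction; does)
open import Relation.Nullary.Decidable using (¬?; _×-dec_; does-⇔; dec-true; dec-false)
open import Relation.Binary.PropositionalEquality

-- Primes in intervals

-- binom a b is the binomial coefficient (a + b choose a).
binom : ℕ → ℕ → ℕ
binom zero    b       = 1
binom (suc a) zero    = 1
binom (suc a) (suc b) = binom a (suc b) + binom (suc a) b

binom-! : ∀ a b → binom a b * (a ! * b !) ≡ (a + b) !
binom-! zero b = trans (+-identityʳ (1 * b !)) (+-identityʳ (b !))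
binom-! (suc a) zero = begin
  1 * (suc a ! * 1) ≡⟨ *-identityˡ (suc a ! * 1) ⟩
  suc a ! * 1       ≡⟨ *-identityʳ (suc a !) ⟩
  suc a !           ≡⟨ cong (λ k → suc k !) (sym (+-identityʳ a)) ⟩
  suc (a + 0) !     ∎
  where open ≡-Reasoning
binom-! (suc a) (suc b) = begin
  (u + v) * (suc a * a ! * (suc b * b !))
    ≡⟨ split u v (suc a) (a !) (suc b) (b !) ⟩
  suc a * (u * (a ! * suc b !)) + suc b * (v * (suc a ! * b !))
    ≡⟨ cong₂ (λ x y → suc a * x + suc b * y) (trans (binom-! a (suc b)) (cong _! (+-suc a b))) (binom-! (suc a) b) ⟩
  suc a * suc (a + b) ! + suc b * suc (a + b) !
    ≡⟨ *-distribʳ-+ (suc (a + b) !) (suc a) (suc b) ⟨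
  (suc a + suc b) * suc (a + b) !
    ≡⟨ cong (λ k → (suc a + suc b) * k !) (sym (+-suc a b)) ⟩
  (suc a + suc b) ! ∎
  where
  open ≡-Reasoning
  u = binom a (suc b)
  v = binom (suc a) b
  split : ∀ u v a x b y → (u + v) * (a * x * (b * y)) ≡ a * (u * (x * (b * y))) + b * (v * (a * x * y))
  split = solve-∀

binom-absorbˡ : ∀ a b → suc a * binom (suc a) b ≡ suc (a + b) * binom a b
binom-absorbˡ a b = *-cancelʳ-≡ _ _ (a ! * b !) {{a !* b !≢0}} (begin
  suc a * binom (suc a) b * (a ! * b !)   ≡⟨ regroup (suc a) (binom (suc a) b) (a !) (b !) ⟩
  binom (suc a) b * (suc a ! * b !)       ≡⟨ binom-! (suc a) b ⟩
  suc (a + b) * (a + b) !                 ≡⟨ cong (suc (a + b) *_) (sym (binom-! a b)) ⟩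
  suc (a + b) * (binom a b * (a ! * b !)) ≡⟨ *-assoc (suc (a + b)) (binom a b) _ ⟨
  suc (a + b) * binom a b * (a ! * b !)   ∎)
  where
  open ≡-Reasoning
  regroup : ∀ a u x y → a * u * (x * y) ≡ u * (a * x * y)
  regroup = solve-∀

binom-absorbʳ : ∀ a b → suc b * binom a (suc b) ≡ suc (a + b) * binom a b
binom-absorbʳ a b = *-cancelʳ-≡ _ _ (a ! * b !) {{a !* b !≢0}} (begin
  suc b * binom a (suc b) * (a ! * b !)   ≡⟨ regroup (suc b) (binom a (suc b)) (a !) (b !) ⟩
  binom a (suc b) * (a ! * suc b !)       ≡⟨ binom-! a (suc b) ⟩
  (a + suc b) !                           ≡⟨ cong _! (+-suc a b) ⟩
  suc (a + b) * (a + b) !                 ≡⟨ cong (suc (a + b) *_) (sym (binom-! a b)) ⟩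
  suc (a + b) * (binom a b * (a ! * b !)) ≡⟨ *-assoc (suc (a + b)) (binom a b) _ ⟨
  suc (a + b) * binom a b * (a ! * b !)   ∎)
  where
  open ≡-Reasoning
  regroup : ∀ a u x y → a * u * (x * y) ≡ u * (x * (a * y))
  regroup = solve-∀

binom>0 : ∀ a b → 0 < binom a b
binom>0 zero    b       = s≤s z≤n
binom>0 (suc a) zero    = s≤s z≤n
binom>0 (suc a) (suc b) = ≤-trans (binom>0 a (suc b)) (m≤m+n _ _)

binom≤2^ : ∀ a b → binom a b ≤ 2 ^ (a + b)
binom≤2^ zero    b       = m^n>0 2 b
binom≤2^ (suc a) zero    = m^n>0 2 (suc a + 0)
binom≤2^ (suc a) (suc b) = begin
  binom a (suc b) + binom (suc a) b
    ≤⟨ +-mono-≤ (binom≤2^ a (suc b)) (≤-trans (binom≤2^ (suc a) b) (≤-reflexive (cong (2 ^_) (sym (+-suc a b))))) ⟩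
  2 ^ (a + suc b) + 2 ^ (a + suc b)
    ≡⟨ cong (λ k → 2 ^ (a + suc b) + k) (sym (+-identityʳ _)) ⟩
  2 ^ (suc a + suc b) ∎
  where open ≤-Reasoning

binom-monoʳ : ∀ a b → binom a b ≤ binom a (suc b)
binom-monoʳ zero    b = ≤-refl
binom-monoʳ (suc a) b = m≤n+m _ _

binom-monoˡ : ∀ a b → binom a b ≤ binom (suc a) b
binom-monoˡ a       (suc b) = m≤m+n _ _
binom-monoˡ zero    zero    = ≤-refl
binom-monoˡ (suc a) zero    = ≤-refl

2^≤binom : ∀ m → 2 ^ m ≤ binom m m
2^≤binom zero    = ≤-refl
2^≤binom (suc m) = begin
  2 ^ m + (2 ^ m + 0)               ≡⟨ cong (λ k → 2 ^ m + k) (+-identityʳ _) ⟩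
  2 ^ m + 2 ^ m                     ≤⟨ +-mono-≤ (2^≤binom m) (2^≤binom m) ⟩
  binom m m + binom m m             ≤⟨ +-mono-≤ (binom-monoʳ m m) (binom-monoˡ m m) ⟩
  binom m (suc m) + binom (suc m) m ∎
  where open ≤-Reasoning

-- The hypothesis on z says 1/z = 1/y - 1/x, so Z/z = Z/y - Z/x is an integer.
∣-harmonic : ∀ {x y z Z} .{{_ : NonZero y}} → z * x ≡ z * y + x * y → x ∣ Z → y ∣ Z → z ∣ Z
∣-harmonic {x} {y} {z} {Z} eq (divides q Z≡qx) (divides r Z≡ry) =
  ∣m+n∣m⇒∣n (subst (z ∣_) z*r≡ (m∣m*n r)) (m∣m*n q)
  where
  open ≡-Reasoning
  r₁ : ∀ z r y → z * r * y ≡ z * (r * y)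
  r₁ = solve-∀
  r₂ : ∀ z q x → z * (q * x) ≡ q * (z * x)
  r₂ = solve-∀
  r₃ : ∀ q z x y → q * (z * y + x * y) ≡ (z * q + q * x) * y
  r₃ = solve-∀
  z*r≡ : z * r ≡ z * q + Z
  z*r≡ = *-cancelʳ-≡ _ _ y (begin
    z * r * y             ≡⟨ r₁ z r y ⟩
    z * (r * y)           ≡⟨ cong (z *_) (trans (sym Z≡ry) Z≡qx) ⟩
    z * (q * x)           ≡⟨ r₂ z q x ⟩
    q * (z * x)           ≡⟨ cong (q *_) eq ⟩
    q * (z * y + x * y)   ≡⟨ r₃ q z x y ⟩
    (z * q + q * x) * y   ≡⟨ cong (λ w → (z * q + w) * y) (sym Z≡qx) ⟩
    (z * q + Z) * y       ∎)

-- These are the reciprocals of Leibniz's harmonic triangle, whose entries are the sum of the two below.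
leibniz-∣ : ∀ {M Z} → (∀ k → 0 < k → k ≤ M → k ∣ Z) →
            ∀ b a → a + b < M → suc (a + b) * binom a b ∣ Z
leibniz-∣ {M} {Z} all zero a lt =
  -- The edge of the triangle consists of the numbers up to M themselves, where the hypothesis
  -- applies.
  subst (_∣ Z) (sym (trans (cong (suc (a + 0) *_) (binom-0 a)) (*-identityʳ _))) (all (suc (a + 0)) (s≤s z≤n) lt)
  where
  binom-0 : ∀ a → binom a 0 ≡ 1
  binom-0 zero    = refl
  binom-0 (suc a) = refl
leibniz-∣ {M} {Z} all (suc b) a lt =
  -- The entry at (a , `suc b`) comes from its neighbour at (`suc a` , b) and the entry at (a , b)
  -- above both.
  ∣-harmonic {{m*n≢0 (suc (a + b)) (binom a b) {{_}} {{>-nonZero (binom>0 a b)}}}} identity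
    (leibniz-∣ all b (suc a) lt′) (leibniz-∣ all b a (<-trans (n<1+n _) lt′))
  where
  open ≡-Reasoning
  lt′ : suc a + b < M
  lt′ = subst (_< M) (+-suc a b) lt
  u = binom (suc a) b
  v = binom a (suc b)
  y = suc (a + b) * binom a b
  r₁ : ∀ c u v → c * v * (c * u) ≡ c * (c * (u * v))
  r₁ = solve-∀
  r₂ : ∀ a b u v → suc (suc (a + b)) * (u * v) ≡ v * (suc a * u) + u * (suc b * v)
  r₂ = solve-∀
  r₃ : ∀ c u v y → c * (v * y + u * y) ≡ c * v * y + c * u * y
  r₃ = solve-∀
  c = suc (suc (a + b))
  core : c * v * (c * u) ≡ c * v * y + c * u * y
  core = begin
    c * v * (c * u)                       ≡⟨ r₁ c u v ⟩
    c * (c * (u * v))                     ≡⟨ cong (c *_) (r₂ a b u v) ⟩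
    c * (v * (suc a * u) + u * (suc b * v)) ≡⟨ cong₂ (λ s t → c * (v * s + u * t)) (binom-absorbˡ a b) (binom-absorbʳ a b) ⟩
    c * (v * y + u * y)                   ≡⟨ r₃ c u v y ⟩
    c * v * y + c * u * y                 ∎
  identity : suc (a + suc b) * v * (c * u) ≡ suc (a + suc b) * v * y + c * u * y
  identity = subst (λ k → suc k * v * (c * u) ≡ suc k * v * y + c * u * y) (sym (+-suc a b)) core

-- The central entry `suc (m + m) * binom m m` of the triangle divides Z, and it is at least
-- `binom m m`, hence at least 2^m.
2^m≤commonMultiple : ∀ {M Z} m → .{{NonZero Z}} → (∀ k → 0 < k → k ≤ M → k ∣ Z) → m + m < M → 2 ^ m ≤ Z
2^m≤commonMultiple {M} {Z} m all lt = begin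
  2 ^ m                     ≤⟨ 2^≤binom m ⟩
  binom m m                 ≤⟨ m≤n*m (binom m m) (suc (m + m)) ⟩
  suc (m + m) * binom m m   ≤⟨ ∣⇒≤ (leibniz-∣ all m m lt) ⟩
  Z                         ∎
  where open ≤-Reasoning

-- Primorials

prime>0 : ∀ {p} → Prime p → 0 < p
prime>0 pr = n≢0⇒n>0 λ { refl → ¬prime[0] pr }

2≤prime : ∀ {p} → Prime p → 2 ≤ p
2≤prime {p} pr = nonTrivial⇒n>1 p {{prime⇒nonTrivial pr}}

prime∣!⇒≤ : ∀ {p} n → Prime p → p ∣ n ! → p ≤ n
prime∣!⇒≤ zero    pr p∣ = contradiction (∣⇒≤ p∣) (<⇒≱ (2≤prime pr))
prime∣!⇒≤ (suc n) pr p∣ with euclidsLemma (suc n) (n !) pr p∣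
... | inj₁ h = ∣⇒≤ h
... | inj₂ h = m≤n⇒m≤1+n (prime∣!⇒≤ n pr h)

primorial : ℕ → ℕ
primorial zero = 1
primorial (suc n) with prime? (suc n)
... | yes _ = suc n * primorial n
... | no  _ = primorial n

prime∣primorial : ∀ {p} n → Prime p → p ≤ n → p ∣ primorial n
prime∣primorial zero    pr p≤ = contradiction p≤ (<⇒≱ (prime>0 pr))
prime∣primorial (suc n) pr p≤ with prime? (suc n) | m≤n⇒m<n∨m≡n p≤
... | yes _ | inj₁ p<   = ∣n⇒∣m*n (suc n) (prime∣primorial n pr (s≤s⁻¹ p<))
... | yes _ | inj₂ refl = m∣m*n (primorial n)
... | no _  | inj₁ p<   = prime∣primorial n pr (s≤s⁻¹ p<)
... | no ¬p | inj₂ refl = contradiction pr ¬p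

prime∣primorial⇒≤ : ∀ {p} n → Prime p → p ∣ primorial n → p ≤ n
prime∣primorial⇒≤ zero    pr p∣ = contradiction (∣⇒≤ p∣) (<⇒≱ (2≤prime pr))
prime∣primorial⇒≤ (suc n) pr p∣ with prime? (suc n)
... | no _  = m≤n⇒m≤1+n (prime∣primorial⇒≤ n pr p∣)
... | yes _ with euclidsLemma (suc n) (primorial n) pr p∣
...   | inj₁ h = ∣⇒≤ h
...   | inj₂ h = m≤n⇒m≤1+n (prime∣primorial⇒≤ n pr h)

primorial>0 : ∀ n → 0 < primorial n
primorial>0 zero = s≤s z≤n
primorial>0 (suc n) with prime? (suc n)
... | yes _ = *-mono-≤ (s≤s (z≤n {n})) (primorial>0 n)
... | no  _ = primorial>0 n

∣! : ∀ {d} n → 0 < d → d ≤ n → d ∣ n !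
∣! {suc d} n _ d≤n = ∣-trans (m∣m*n (d !)) (m≤n⇒m!∣n! d≤n)

-- Euclid's lemma applied to `binom-!`: p divides (2m)! because p ≤ 2m, but it does not divide m!
-- because m < p.
prime∣binom : ∀ {p} m → Prime p → m < p → p ≤ m + m → p ∣ binom m m
prime∣binom {p} m pr m<p p≤2m
  with euclidsLemma (binom m m) (m ! * m !) pr
         (subst (p ∣_) (sym (binom-! m m)) (∣! (m + m) (prime>0 pr) p≤2m))
... | inj₁ h = h
... | inj₂ h with euclidsLemma (m !) (m !) pr h
...   | inj₁ h′ = contradiction (prime∣!⇒≤ m pr h′) (<⇒≱ m<p)
...   | inj₂ h′ = contradiction (prime∣!⇒≤ m pr h′) (<⇒≱ m<p)

-- Induction on j. A new prime `suc j + m` lies in (m , 2m], so it divides `binom m m`; being too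
-- large to divide `primorial (j + m)`, it must divide the cofactor c.
primorial-∣ : ∀ m j → j ≤ m → primorial (j + m) ∣ primorial m * binom m m
primorial-∣ m zero    j≤m = m∣m*n (binom m m)
primorial-∣ m (suc j) j<m with prime? (suc j + m) | primorial-∣ m j (<⇒≤ j<m)
... | no _   | ih = ih
... | yes pr | divides c eq with euclidsLemma c (primorial (j + m)) pr
        (subst (suc j + m ∣_) eq (∣n⇒∣m*n (primorial m) (prime∣binom m pr (s≤s (m≤n+m m j)) (+-monoˡ-≤ m j<m))))
...   | inj₁ h = subst (suc (j + m) * primorial (j + m) ∣_) (sym eq) (*-monoˡ-∣ (primorial (j + m)) h)
...   | inj₂ h = contradiction (prime∣primorial⇒≤ (j + m) pr h) (<⇒≱ (n<1+n _))

-- The bound 4^n on the primorial, at powers of two: passing from m to 2m costs a factor of at most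
-- `binom m m` ≤ 4^m.
primorial-2^ : ∀ k → primorial (2 ^ k) ≤ 2 ^ (2 * 2 ^ k)
primorial-2^ zero    = s≤s z≤n
primorial-2^ (suc k) = begin
  primorial (2 * 2 ^ k)                           ≡⟨ cong primorial (cong (λ x → 2 ^ k + x) (+-identityʳ _)) ⟩
  primorial (m + m)                               ≤⟨ ∣⇒≤ {{m*n≢0 _ _ {{>-nonZero (primorial>0 m)}} {{>-nonZero (binom>0 m m)}}}} (primorial-∣ m m ≤-refl) ⟩
  primorial m * binom m m                         ≤⟨ *-mono-≤ (primorial-2^ k) (binom≤2^ m m) ⟩
  2 ^ (2 * m) * 2 ^ (m + m)                       ≡⟨ ^-distribˡ-+-* 2 (2 * m) (m + m) ⟨
  2 ^ (2 * m + (m + m))                           ≡⟨ cong (2 ^_) (r m) ⟩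
  2 ^ (2 * (2 * m))                               ∎
  where
  open ≤-Reasoning
  m = 2 ^ k
  r : ∀ m → 2 * m + (m + m) ≡ 2 * (2 * m)
  r = solve-∀

-- A weak Bertrand postulate

!≤^ : ∀ n → n ! ≤ n ^ n
!≤^ zero    = ≤-refl
!≤^ (suc n) = *-monoʳ-≤ (suc n) (≤-trans (!≤^ n) (^-monoˡ-≤ n (n≤1+n n)))

product∣!^ : ∀ s {ps} → All (λ p → Prime p × p ≤ s) ps → product ps ∣ (s !) ^ length ps
product∣!^ s []               = ∣-refl
product∣!^ s ((pr , p≤s) ∷ h) = *-pres-∣ (∣! s (prime>0 pr) p≤s) (product∣!^ s h)

2^length≤product : ∀ {ps} → All Prime ps → 2 ^ length ps ≤ product ps
2^length≤product []       = ≤-refl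
2^length≤product (pr ∷ h) = *-mono-≤ (2≤prime pr) (2^length≤product h)

-- At most one prime factor of a number k ≤ s² exceeds s, and the others divide s !.
product∣primorial*!^ : ∀ N s {ps} → All Prime ps → All (_≤ N) ps → product ps ≤ s * s →
                       product ps ∣ primorial N * (s !) ^ length ps
product∣primorial*!^ N s []                []         _  = 1∣ _
product∣primorial*!^ N s {p ∷ ps} (pr ∷ prs) (p≤N ∷ h) le with p ≤? s
... | yes p≤s = subst (p * product ps ∣_) (r (s !) (primorial N) _)
        (*-pres-∣ (∣! s (prime>0 pr) p≤s) (product∣primorial*!^ N s prs h
          (≤-trans (m≤n*m (product ps) p {{prime⇒nonZero pr}}) le)))
  where
  r : ∀ a b c → a * (b * c) ≡ b * (a * c)
  r = solve-∀
... | no p≰s = *-pres-∣ (prime∣primorial N pr p≤N)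
        -- Since s * `product ps` < p * `product ps` ≤ s * s, the remaining factors multiply to less
        -- than s, so each is at most s.
        (∣n⇒∣m*n (s !) (product∣!^ s (small prs (<⇒≤ (*-cancelˡ-< s _ _ (<-≤-trans lt le))))))
  where
  s<p : s < p
  s<p = ≰⇒> p≰s
  lt : s * product ps < p * product ps
  lt = *-monoˡ-< (product ps) {{productOfPrimes≢0 prs}} s<p
  small : ∀ {qs} → All Prime qs → product qs ≤ s → All (λ q → Prime q × q ≤ s) qs
  small []                    _  = []
  small {q ∷ qs} (qr ∷ qrs) le = (qr , ≤-trans (m≤m*n q (product qs) {{productOfPrimes≢0 qrs}}) le)
    ∷ small qrs (≤-trans (m≤n*m (product qs) q {{prime⇒nonZero qr}}) le)

factors∣product : ∀ ps → All (_∣ product ps) ps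
factors∣product []       = []
factors∣product (p ∷ ps) = m∣m*n (product ps) ∷ All.map (∣n⇒∣m*n p) (factors∣product ps)

-- The prime factors of k are at most s², hence at most N by the gap, and there are at most l of
-- them because 2^(their number) ≤ k ≤ 2^l.
noPrimes⇒∣ : ∀ N s l → (∀ p → Prime p → p ≤ s * s → p ≤ N) → s * s ≤ 2 ^ l →
             ∀ k → 0 < k → k ≤ s * s → k ∣ primorial N * (s !) ^ l
noPrimes⇒∣ N s l gap s²≤ k@(suc _) _ k≤ = subst (_∣ primorial N * (s !) ^ l) (sym k≡)
  (∣-trans (product∣primorial*!^ N s prs ps≤N (subst (_≤ s * s) k≡ k≤))
    (*-monoʳ-∣ (primorial N) (^-monoʳ-∣ (s !) len≤)))
  where
  open PrimeFactorisation (factorise k) renaming (factors to ps; factorsPrime to prs; isFactorisation to k≡)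
  ps≤N : All (_≤ N) ps
  ps≤N = All.zipWith (λ { (pr , p∣) → gap _ pr (≤-trans (∣⇒≤ (subst (_ ∣_) (sym k≡) p∣)) k≤) })
           (prs , factors∣product ps)
  len≤ : length ps ≤ l
  len≤ = ≮⇒≥ λ l< → <⇒≱ (^-monoʳ-< 2 (s≤s (s≤s z≤n)) l<)
    (≤-trans (2^length≤product prs) (≤-trans (≤-reflexive (sym k≡)) (≤-trans k≤ s²≤)))
  ^-monoʳ-∣ : ∀ a {m n} → m ≤ n → a ^ m ∣ a ^ n
  ^-monoʳ-∣ a {zero}          _       = 1∣ _
  ^-monoʳ-∣ a {suc m} {suc n} (s≤s h) = *-monoʳ-∣ a (^-monoʳ-∣ a h)

-- The size condition of `weakBertrand`. It starts at exponent 9, where it reads 484 < 512, and the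
-- right side doubles from then on.
4*[2+r]²<2^r : ∀ r → 4 * ((2 + (9 + r)) * (2 + (9 + r))) < 2 ^ (9 + r)
4*[2+r]²<2^r zero    = <ᵇ⇒< _ _ _
4*[2+r]²<2^r (suc r) = begin-strict
  4 * ((12 + r) * (12 + r))                     ≤⟨ m≤m+n _ _ ⟩
  4 * ((12 + r) * (12 + r)) + (392 + 80 * r + 4 * (r * r)) ≡⟨ eq r ⟩
  2 * (4 * ((11 + r) * (11 + r)))               <⟨ *-monoʳ-< 2 (4*[2+r]²<2^r r) ⟩
  2 * 2 ^ (9 + r)                               ∎
  where
  open ≤-Reasoning
  eq : ∀ r → 4 * ((12 + r) * (12 + r)) + (392 + 80 * r + 4 * (r * r)) ≡ 2 * (4 * ((11 + r) * (11 + r)))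
  eq = solve-∀

-- A weak Bertrand postulate: were there no such prime, all k ≤ 16·4^r would divide
-- primorial (4^r) * (s !) ^ l with s = 4·2^r, which is smaller than 2 ^ (4·4^r).
weakBertrand : ∀ r → 4 * ((2 + r) * (2 + r)) < 2 ^ r →
               ∃ λ p → Prime p × 2 ^ r * 2 ^ r < p × p ≤ 16 * (2 ^ r * 2 ^ r)
weakBertrand r large with anyUpTo? (λ p → prime? p ×-dec (2 ^ r * 2 ^ r <? p)) (suc ((4 * 2 ^ r) * (4 * 2 ^ r)))
... | yes (p , p< , pr , h²<p) = p , pr , h²<p , ≤-trans (s≤s⁻¹ p<) (≤-reflexive (eq (2 ^ r)))
  where
  eq : ∀ h → (4 * h) * (4 * h) ≡ 16 * (h * h)
  eq = solve-∀
... | no ¬∃ = contradiction (2^m≤commonMultiple {Z = Z} (4 * N) {{>-nonZero Z>0}} all 2m<M) (<⇒≱ Z<)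
  where
  open ≤-Reasoning
  h = 2 ^ r
  N = h * h
  s = 4 * h
  -- As s = 2^(2 + r), this makes s * s equal to 2^l.
  l = (2 + r) + (2 + r)
  Z = primorial N * (s !) ^ l
  h≢0 : NonZero h
  h≢0 = m^n≢0 2 r
  N≢0 : NonZero N
  N≢0 = m*n≢0 h h {{h≢0}} {{h≢0}}
  Z>0 : 0 < Z
  Z>0 = *-mono-≤ (primorial>0 N) (m^n>0 (s !) {{s !≢0}} l)
  gap : ∀ p → Prime p → p ≤ s * s → p ≤ N
  gap p pr p≤ = ≮⇒≥ λ N<p → ¬∃ (p , s≤s p≤ , pr , N<p)
  s≡ : s ≡ 2 ^ (2 + r)
  s≡ = *-assoc 2 2 h
  all : ∀ k → 0 < k → k ≤ s * s → k ∣ Z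
  all = noPrimes⇒∣ N s l gap (≤-reflexive (trans (cong₂ _*_ s≡ s≡) (sym (^-distribˡ-+-* 2 (2 + r) (2 + r)))))
  2m<M : 4 * N + 4 * N < s * s
  2m<M = begin-strict
    4 * N + 4 * N  <⟨ m<m+n (4 * N + 4 * N) (>-nonZero⁻¹ (8 * N) {{m*n≢0 8 N {{_}} {{N≢0}}}}) ⟩
    4 * N + 4 * N + 8 * N ≡⟨ eq h ⟩
    s * s          ∎
    where
    eq : ∀ h → 4 * (h * h) + 4 * (h * h) + 8 * (h * h) ≡ (4 * h) * (4 * h)
    eq = solve-∀
  s!^l≤ : (s !) ^ l ≤ 2 ^ ((2 + r) * s * l)
  s!^l≤ = begin
    (s !) ^ l              ≤⟨ ^-monoˡ-≤ l (!≤^ s) ⟩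
    (s ^ s) ^ l            ≡⟨ cong (λ x → (x ^ s) ^ l) s≡ ⟩
    ((2 ^ (2 + r)) ^ s) ^ l ≡⟨ cong (_^ l) (^-*-assoc 2 (2 + r) s) ⟩
    (2 ^ ((2 + r) * s)) ^ l ≡⟨ ^-*-assoc 2 ((2 + r) * s) l ⟩
    2 ^ ((2 + r) * s * l)  ∎
  Z< : Z < 2 ^ (4 * N)
  Z< = begin-strict
    primorial N * (s !) ^ l                     ≤⟨ *-monoˡ-≤ ((s !) ^ l) (subst (λ x → primorial x ≤ 2 ^ (2 * x)) (^-distribˡ-+-* 2 r r) (primorial-2^ (r + r))) ⟩
    2 ^ (2 * N) * (s !) ^ l                     ≤⟨ *-monoʳ-≤ (2 ^ (2 * N)) s!^l≤ ⟩
    2 ^ (2 * N) * 2 ^ ((2 + r) * s * l)         ≡⟨ ^-distribˡ-+-* 2 (2 * N) _ ⟨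
    2 ^ (2 * N + (2 + r) * s * l)               ≡⟨ cong (2 ^_) (eq₁ (2 + r) h) ⟩
    -- The contribution of the small primes has exponent 8(2 + r)²h, which is below 2h² = 2N by
    -- `large`.
    2 ^ (2 * N + 2 * ((4 * ((2 + r) * (2 + r))) * h)) <⟨ ^-monoʳ-< 2 (s≤s (s≤s z≤n)) (+-monoʳ-< (2 * N) (*-monoʳ-< 2 (*-monoˡ-< h {{h≢0}} large))) ⟩
    2 ^ (2 * N + 2 * N)                         ≡⟨ cong (2 ^_) (eq₂ N) ⟩
    2 ^ (4 * N)                                 ∎
    where
    eq₁ : ∀ q h → 2 * (h * h) + q * (4 * h) * (q + q) ≡ 2 * (h * h) + 2 * ((4 * (q * q)) * h)
    eq₁ = solve-∀
    eq₂ : ∀ N → 2 * N + 2 * N ≡ 4 * N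
    eq₂ = solve-∀

-- A prime near the square root of n

bracketPower : ∀ b .{{_ : NonZero b}} → 1 < b → ∀ k n → b ^ k ≤ n → ∃ λ r → b ^ (k + r) ≤ n × n < b ^ suc (k + r)
bracketPower b 1<b k n b^k≤n = search n (<-≤-trans (n<b^n n) (^-monoʳ-≤ b (m≤n+m n k)))
  where
  n<b^n : ∀ n → n < b ^ n
  n<b^n zero    = s≤s z≤n
  n<b^n (suc n) = ≤-trans (s≤s (n<b^n n)) (subst (b ^ n <_) (*-comm (b ^ n) b) (m<m*n (b ^ n) b {{m^n≢0 b n}} 1<b))
  search : ∀ j → n < b ^ (k + j) → ∃ λ r → b ^ (k + r) ≤ n × n < b ^ suc (k + r)
  search zero    lt = contradiction (subst (λ e → n < b ^ e) (+-identityʳ k) lt) (≤⇒≯ b^k≤n)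
  search (suc j) lt with b ^ (k + j) ≤? n
  ... | yes le = j , le , subst (λ e → n < b ^ e) (+-suc k j) lt
  ... | no nle = search j (≰⇒> nle)

-- The bounds on p give b^q < p² ≤ b^(2 + q), so p² is at most n and is within a factor b³ of it.
squareSandwich : ∀ b h q p n → (h * h) * (h * h) ≡ b ^ q → h * h < p → p ≤ b * (h * h) →
                 b ^ (2 + q) ≤ n → n < b ^ (3 + q) → p * p ≤ n × n ≤ b * b * b * (p * p)
squareSandwich b h q p n h⁴≡ h²<p p≤ le lt = upper , lower
  where
  open ≤-Reasoning
  eq₁ : ∀ b x → b * x * (b * x) ≡ b * (b * (x * x))
  eq₁ = solve-∀
  eq₂ : ∀ b x → b * (b * (b * x)) ≡ b * b * b * x
  eq₂ = solve-∀
  upper : p * p ≤ n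
  upper = begin
    p * p                              ≤⟨ *-mono-≤ p≤ p≤ ⟩
    b * (h * h) * (b * (h * h))        ≡⟨ eq₁ b (h * h) ⟩
    b * (b * (h * h * (h * h)))        ≡⟨ cong (λ x → b * (b * x)) h⁴≡ ⟩
    b ^ (2 + q)                        ≤⟨ le ⟩
    n                                  ∎
  lower : n ≤ b * b * b * (p * p)
  lower = begin
    n                                  ≤⟨ <⇒≤ lt ⟩
    b ^ (3 + q)                        ≡⟨ eq₂ b (b ^ q) ⟩
    b * b * b * b ^ q                  ≡⟨ cong (b * b * b *_) h⁴≡ ⟨
    b * b * b * ((h * h) * (h * h))    ≤⟨ *-monoʳ-≤ (b * b * b) (*-mono-≤ (<⇒≤ h²<p) (<⇒≤ h²<p)) ⟩
    b * b * b * (p * p)                ∎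

-- The base and the offset are kept abstract to prevent the type checker from evaluating powers.
primeNearSqrt′ : ∀ b k → 1 < b → (∀ r → (2 ^ r * 2 ^ r) * (2 ^ r * 2 ^ r) ≡ b ^ r) →
  (∀ r → ∃ λ p → Prime p × 2 ^ (k + r) * 2 ^ (k + r) < p × p ≤ b * (2 ^ (k + r) * 2 ^ (k + r))) →
  ∀ n → b ^ (2 + k) ≤ n → ∃ λ p → Prime p × p * p ≤ n × n ≤ b * b * b * (p * p)
primeNearSqrt′ b k 1<b 2^r⁴≡b^r primes n n≥ with bracketPower b {{>-nonZero (<⇒≤ 1<b)}} 1<b (2 + k) n n≥
... | r , le , lt with primes r
...   | p , pr , h²<p , p≤ = p , pr , squareSandwich b (2 ^ (k + r)) (k + r) p n (2^r⁴≡b^r (k + r)) h²<p p≤ le lt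

primeNearSqrt : ∃ λ K → ∃ λ N → ∀ n → N ≤ n → ∃ λ p → Prime p × p * p ≤ n × n ≤ K * (p * p)
-- The base 16 is both the ratio allowed by `weakBertrand` and 2^4, which makes (2^r)^4 a power of
-- it. The 9 comes from `4*[2+r]²<2^r`.
primeNearSqrt = 16 * 16 * 16 , 16 ^ (2 + 9) ,
  primeNearSqrt′ 16 9 (s≤s (s≤s z≤n)) 2^r⁴≡16^r (λ r → weakBertrand (9 + r) (4*[2+r]²<2^r r))
  where
  eq : ∀ x → (x * x) * (x * x) ≡ x * (x * (x * (x * 1)))
  eq = solve-∀
  2^r⁴≡16^r : ∀ r → (2 ^ r * 2 ^ r) * (2 ^ r * 2 ^ r) ≡ 16 ^ r
  2^r⁴≡16^r r = begin
    (2 ^ r * 2 ^ r) * (2 ^ r * 2 ^ r)   ≡⟨ eq (2 ^ r) ⟩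
    (2 ^ r) ^ 4                         ≡⟨ ^-*-assoc 2 r 4 ⟩
    2 ^ (r * 4)                         ≡⟨ cong (2 ^_) (*-comm r 4) ⟩
    2 ^ (4 * r)                         ≡⟨ ^-*-assoc 2 4 r ⟨
    16 ^ r                              ∎
    where open ≡-Reasoning

-- Finite sets and the upper bound

private variable
  ℓ : Level
  A : Set ℓ
  k n N : ℕ

injection⇒≤length : (xs : List A) (f : Fin N → A) → Injective _≡_ _≡_ f →
                    (∀ i → f i List.∈ xs) → N ≤ length xs
injection⇒≤length xs f inj f∈ =
  injective⇒≤ {f = λ i → Any.index (f∈ i)} λ {i} {j} eq → inj (index-injective (setoid _) (f∈ i) (f∈ j) eq)

lookup-injective : {xs : List A} → Unique xs → Injective _≡_ _≡_ (lookup xs)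
lookup-injective (x≢ ∷ u) {zero}  {zero}  eq = refl
lookup-injective (x≢ ∷ u) {zero}  {suc j} eq = contradiction eq (All.lookup x≢ (∈-lookup j))
lookup-injective (x≢ ∷ u) {suc i} {zero}  eq = contradiction (sym eq) (All.lookup x≢ (∈-lookup i))
lookup-injective (x≢ ∷ u) {suc i} {suc j} eq = cong suc (lookup-injective u eq)

-- The code g receives the membership proof, since a copy is encoded by means of the proof that it
-- is one.
length≤injection : {xs : List A} → Unique xs → (g : ∀ {x} → x List.∈ xs → Fin N) →
                   (∀ {x y} (p : x List.∈ xs) (q : y List.∈ xs) → g p ≡ g q → x ≡ y) → length xs ≤ N
length≤injection u g inj =
  injective⇒≤ {f = λ i → g (∈-lookup i)} λ {i} {j} eq → lookup-injective u (inj (∈-lookup i) (∈-lookup j) eq)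

private
  extend : Subset n → List (Subset (suc n))
  extend s = (true ∷ s) ∷ (false ∷ s) ∷ []

  ∈-extend⁻ : ∀ {b} {s : Subset n} xs → (b ∷ s) List.∈ concatMap extend xs → s List.∈ xs
  ∈-extend⁻ (x ∷ xs) (Any.here refl)              = Any.here refl
  ∈-extend⁻ (x ∷ xs) (Any.there (Any.here refl))  = Any.here refl
  ∈-extend⁻ (x ∷ xs) (Any.there (Any.there h))    = Any.there (∈-extend⁻ xs h)

  ∈-extend⁺ : ∀ b {s : Subset n} {xs} → s List.∈ xs → (b ∷ s) List.∈ concatMap extend xs
  ∈-extend⁺ true  (Any.here refl) = Any.here refl
  ∈-extend⁺ false (Any.here refl) = Any.there (Any.here refl)
  ∈-extend⁺ b     (Any.there h)   = Any.there (Any.there (∈-extend⁺ b h))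

  extend-unique : {xs : List (Subset n)} → Unique xs → Unique (concatMap extend xs)
  extend-unique []       = []
  extend-unique {xs = x ∷ xs} (x≢ ∷ u) = ((λ ()) ∷ fresh) ∷ fresh ∷ extend-unique u
    where
    fresh : ∀ {b} → All ((b ∷ x) ≢_) (concatMap extend xs)
    fresh = All.tabulate λ { h refl → All.lookup x≢ (∈-extend⁻ xs h) refl }

∈-allSubsets : (s : Subset n) → s List.∈ allSubsets n
∈-allSubsets []      = Any.here refl
∈-allSubsets (b ∷ s) = ∈-extend⁺ b (∈-allSubsets s)

allSubsets-unique : ∀ n → Unique (allSubsets n)
allSubsets-unique zero    = [] ∷ []
allSubsets-unique (suc n) = extend-unique (allSubsets-unique n)

-- Elements, images and sizes of subsets

nth : (S : Subset n) → Fin ∣ S ∣ → Fin n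
nth (true ∷ S)  zero    = zero
nth (true ∷ S)  (suc i) = suc (nth S i)
nth (false ∷ S) i       = suc (nth S i)

nth-∈ : (S : Subset n) (i : Fin ∣ S ∣) → nth S i ∈ S
nth-∈ (true ∷ S)  zero    = here
nth-∈ (true ∷ S)  (suc i) = there (nth-∈ S i)
nth-∈ (false ∷ S) i       = there (nth-∈ S i)

nth-injective : (S : Subset n) → Injective _≡_ _≡_ (nth S)
nth-injective (true ∷ S)  {zero}  {zero}  eq = refl
nth-injective (true ∷ S)  {suc i} {suc j} eq = cong suc (nth-injective S (Fin.suc-injective eq))
nth-injective (false ∷ S) eq                 = nth-injective S (Fin.suc-injective eq)

subsetOfSize : (S : Subset n) → k ≤ ∣ S ∣ → ∃ λ T → T ⊆ S × ∣ T ∣ ≡ k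
subsetOfSize {n} {zero}  S           _  = ⊥ , (λ h → contradiction h ∉⊥) , ∣⊥∣≡0 n
subsetOfSize {k = suc _} (true ∷ S)  le with subsetOfSize S (s≤s⁻¹ le)
... | T , T⊆S , eq = true ∷ T , s⊆s T⊆S , cong suc eq
subsetOfSize {k = suc _} (false ∷ S) le with subsetOfSize S le
... | T , T⊆S , eq = false ∷ T , s⊆s T⊆S , eq

∣⁅x⁆∪S∣ : ∀ x (S : Subset n) → x ∉ S → ∣ ⁅ x ⁆ ∪ S ∣ ≡ suc ∣ S ∣
∣⁅x⁆∪S∣ zero    (true ∷ S)  x∉S = contradiction here x∉S
∣⁅x⁆∪S∣ zero    (false ∷ S) x∉S = cong (suc ∘ ∣_∣) (∪-identityˡ S)
∣⁅x⁆∪S∣ (suc x) (true ∷ S)  x∉S = cong suc (∣⁅x⁆∪S∣ x S (x∉S ∘ there))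
∣⁅x⁆∪S∣ (suc x) (false ∷ S) x∉S = ∣⁅x⁆∪S∣ x S (x∉S ∘ there)

image : (Fin k → Fin n) → Subset n
image {zero}  f = ⊥
image {suc k} f = ⁅ f zero ⁆ ∪ image (f ∘ suc)

∈-image⁺ : (f : Fin k → Fin n) (i : Fin k) → f i ∈ image f
∈-image⁺ f zero    = x∈p∪q⁺ (inj₁ (x∈⁅x⁆ (f zero)))
∈-image⁺ f (suc i) = x∈p∪q⁺ (inj₂ (∈-image⁺ (f ∘ suc) i))

∈-image⁻ : (f : Fin k → Fin n) {x : Fin n} → x ∈ image f → ∃ λ i → x ≡ f i
∈-image⁻ {zero}  f x∈ = contradiction x∈ ∉⊥
∈-image⁻ {suc k} f x∈ with x∈p∪q⁻ ⁅ f zero ⁆ (image (f ∘ suc)) x∈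
... | inj₁ h = zero , x∈⁅y⁆⇒x≡y (f zero) h
... | inj₂ h with ∈-image⁻ (f ∘ suc) h
...   | i , eq = suc i , eq

∣image∣ : (f : Fin k → Fin n) → Injective _≡_ _≡_ f → ∣ image f ∣ ≡ k
∣image∣ {zero} {n} f inj = ∣⊥∣≡0 n
∣image∣ {suc k} f inj = trans
  (∣⁅x⁆∪S∣ (f zero) (image (f ∘ suc)) λ h → case∈ (∈-image⁻ (f ∘ suc) h))
  (cong suc (∣image∣ (f ∘ suc) (Fin.suc-injective ∘ inj)))
  where
  case∈ : ¬ ∃ λ i → f zero ≡ f (suc i)
  case∈ (i , eq) with () ← inj eq

⊆∧∣∣≥⇒≡ : {S T : Subset n} → S ⊆ T → ∣ T ∣ ≤ ∣ S ∣ → S ≡ T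
⊆∧∣∣≥⇒≡ {S = S} {T} S⊆T le = ⊆-antisym S⊆T λ {x} x∈T → back x x∈T
  where
  back : ∀ x → x ∈ T → x ∈ S
  back x x∈T with x ∈? S
  ... | yes h = h
  ... | no ¬h = contradiction (p⊂q⇒∣p∣<∣q∣ (S⊆T , x , x∈T , ¬h)) (≤⇒≯ le)

-- Common neighbourhoods and the upper bound

Adjacent : Graph n → Fin n → Fin n → Set
Adjacent G u v = adj G u v ≡ true

adjacent⇒≢ : (G : Graph n) {u v : Fin n} → Adjacent G u v → u ≢ v
adjacent⇒≢ G {u} uv refl with () ← trans (sym uv) (irrefl G u)

-- Otherwise `suc t` elements of S together with u and v form a K_{2,t+1}; its sides are disjoint
-- because no vertex is adjacent to itself.
commonNeighbours≤ : ∀ {t} (G : Graph n) → KabFree 2 (suc t) G → ∀ {u v} → u ≢ v → (S : Subset n) →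
                    (∀ {w} → w ∈ S → Adjacent G u w × Adjacent G v w) → ∣ S ∣ ≤ t
commonNeighbours≤ {t = t} G free {u} {v} u≢v S nb = ≮⇒≥ λ t<∣S∣ → contra (subsetOfSize S t<∣S∣)
  where
  contra : ¬ ∃ λ T → T ⊆ S × ∣ T ∣ ≡ suc t
  contra (T , T⊆S , ∣T∣) = free (⁅ u ⁆ ∪ ⁅ v ⁆ , T , size , ∣T∣ , disj , λ _ _ x∈ w∈ → compl x∈ (T⊆S w∈))
    where
    size : ∣ ⁅ u ⁆ ∪ ⁅ v ⁆ ∣ ≡ 2
    size = trans (∣⁅x⁆∪S∣ u ⁅ v ⁆ (x≢y⇒x∉⁅y⁆ u≢v)) (cong suc (∣⁅x⁆∣≡1 v))
    compl : ∀ {x w} → x ∈ ⁅ u ⁆ ∪ ⁅ v ⁆ → w ∈ S → Adjacent G x w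
    compl x∈ w∈ with x∈p∪q⁻ ⁅ u ⁆ ⁅ v ⁆ x∈
    ... | inj₁ h with refl ← x∈⁅y⁆⇒x≡y u h = proj₁ (nb w∈)
    ... | inj₂ h with refl ← x∈⁅y⁆⇒x≡y v h = proj₂ (nb w∈)
    disj : Disjoint (⁅ u ⁆ ∪ ⁅ v ⁆) T
    disj x x∈ x∈T = adjacent⇒≢ G (compl x∈ (T⊆S x∈T)) refl

-- The union `B ∪ B′` also consists of common neighbours, so it has at most t elements and equals
-- both sets.
commonNeighbourhood-unique : ∀ {t} (G : Graph n) → KabFree 2 (suc t) G → ∀ {u v} → u ≢ v → {B B′ : Subset n} →
  ∣ B ∣ ≡ t → ∣ B′ ∣ ≡ t →
  (∀ {w} → w ∈ B → Adjacent G u w × Adjacent G v w) →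
  (∀ {w} → w ∈ B′ → Adjacent G u w × Adjacent G v w) → B ≡ B′
commonNeighbourhood-unique {t = t} G free u≢v {B} {B′} ∣B∣ ∣B′∣ nb nb′ =
  trans (⊆∧∣∣≥⇒≡ (p⊆p∪q B′) (≤-trans le (≤-reflexive (sym ∣B∣))))
        (sym (⊆∧∣∣≥⇒≡ (q⊆p∪q B B′) (≤-trans le (≤-reflexive (sym ∣B′∣)))))
  where
  le : ∣ B ∪ B′ ∣ ≤ t
  le = commonNeighbours≤ G free u≢v (B ∪ B′) λ w∈ → [ nb , nb′ ]′ (x∈p∪q⁻ B B′ w∈)

twoElements : (S : Subset n) → 2 ≤ ∣ S ∣ → ∃ λ u → ∃ λ v → u ≢ v × u ∈ S × v ∈ S
twoElements S 2≤ = nth S i , nth S j , (λ eq → i≢j (nth-injective S eq)) , nth-∈ S i , nth-∈ S j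
  where
  i = Fin.fromℕ< (<⇒≤ 2≤)
  j = Fin.fromℕ< 2≤
  i≢j : i ≢ j
  i≢j eq with () ← trans (sym (Fin.toℕ-fromℕ< (<⇒≤ 2≤))) (trans (cong Fin.toℕ eq) (Fin.toℕ-fromℕ< 2≤))

-- A copy is encoded by the pair of vertices that `twoElements` picks from A, and `determined`
-- recovers the copy from it.
orderedKtt≤n² : ∀ {t} → 2 ≤ t → (G : Graph n) → KabFree 2 (suc t) G → orderedKtt t G ≤ n * n
orderedKtt≤n² {n} {t} 2≤t G free =
  length≤injection (Unique.filter⁺ P? (Unique.cartesianProduct⁺ (allSubsets-unique n) (allSubsets-unique n)))
    (λ h → code (isK h)) (λ h h′ eq → code-injective (isK h) (isK h′) eq)
  where
  P? = isKab? t t G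
  IsK : Subset n × Subset n → Set
  IsK (A , B) = IsKab t t G A B
  isK : ∀ {AB} → AB List.∈ filter P? (cartesianProduct (allSubsets n) (allSubsets n)) → IsK AB
  isK h = proj₂ (∈-filter⁻ P? {xs = cartesianProduct (allSubsets n) (allSubsets n)} h)
  two : (S : Subset n) → ∣ S ∣ ≡ t → ∃ λ u → ∃ λ v → u ≢ v × u ∈ S × v ∈ S
  two S ∣S∣ = twoElements S (≤-trans 2≤t (≤-reflexive (sym ∣S∣)))
  code : ∀ {AB} → IsK AB → Fin (n * n)
  code {A , B} (∣A∣ , _) = combine (proj₁ (two A ∣A∣)) (proj₁ (proj₂ (two A ∣A∣)))
  adj-sym : ∀ {u v} → Adjacent G u v → Adjacent G v u
  adj-sym {u} {v} = trans (Graph.sym G v u)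
  determined : ∀ {A B A′ B′ u v} → IsK (A , B) → IsK (A′ , B′) → u ≢ v →
               u ∈ A → v ∈ A → u ∈ A′ → v ∈ A′ → (A , B) ≡ (A′ , B′)
  determined {A} {B} (∣A∣ , ∣B∣ , _ , com) (∣A′∣ , ∣B′∣ , _ , com′) u≢v u∈A v∈A u∈A′ v∈A′
    with refl ← commonNeighbourhood-unique G free u≢v ∣B∣ ∣B′∣
                  (λ w∈ → com _ _ u∈A w∈ , com _ _ v∈A w∈)
                  (λ w∈ → com′ _ _ u∈A′ w∈ , com′ _ _ v∈A′ w∈)
    with x , y , x≢y , x∈B , y∈B ← two B ∣B∣
    with refl ← commonNeighbourhood-unique G free x≢y ∣A∣ ∣A′∣
                  (λ w∈ → adj-sym (com _ _ w∈ x∈B) , adj-sym (com _ _ w∈ y∈B))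
                  (λ w∈ → adj-sym (com′ _ _ w∈ x∈B) , adj-sym (com′ _ _ w∈ y∈B))
    = refl
  code-injective : ∀ {AB AB′} (K : IsK AB) (K′ : IsK AB′) → code K ≡ code K′ → AB ≡ AB′
  code-injective {A , B} {A′ , B′} K@(∣A∣ , _) K′@(∣A′∣ , _) eq =
    let u  , v  , u≢v , u∈A  , v∈A  = two A ∣A∣
        u′ , v′ , _   , u∈A′ , v∈A′ = two A′ ∣A′∣
        u≡ , v≡ = combine-injective u v u′ v′ eq
    in determined K K′ u≢v u∈A v∈A (subst (_∈ A′) (sym u≡) u∈A′) (subst (_∈ A′) (sym v≡) v∈A′)

copiesKtt≤n² : ∀ {t} → 2 ≤ t → (G : Graph n) → KabFree 2 (suc t) G → copiesKtt t G ≤ n * n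
copiesKtt≤n² 2≤t G free = ≤-trans (m/n≤m (orderedKtt _ G) 2) (orderedKtt≤n² 2≤t G free)

-- The lower bound

argmax : ∀ {p} .{{_ : NonZero p}} (h : Fin p → ℕ) → ∃ λ i → ∀ j → h j ≤ h i
argmax {suc zero}    h = zero , λ { zero → ≤-refl }
argmax {suc (suc p)} h with argmax (h ∘ suc)
... | i , max with ≤-total (h zero) (h (suc i))
...   | inj₁ le = suc i , λ { zero → le ; (suc j) → max j }
...   | inj₂ ge = zero , λ { zero → ≤-refl ; (suc j) → ≤-trans (max j) ge }

-- Let e have the largest fibre. Sending i to `f i` and its position within its own fibre embeds
-- `Fin M` into `Fin (p * F)`.
largeFibre : ∀ {M p} .{{_ : NonZero p}} (f : Fin M → Fin p) →
             ∃ λ e → ∃ λ F → Σ (Fin F → Fin M) λ g →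
             Injective _≡_ _≡_ g × (∀ k → f (g k) ≡ e) × M ≤ p * F
largeFibre {M} {p} f with argmax (λ e → length (filter (λ i → f i Fin.≟ e) (allFin M)))
... | e , max = e , length (fibre e) , lookup (fibre e) ,
      lookup-injective (Unique.filter⁺ (λ i → f i Fin.≟ e) (Unique.allFin⁺ M)) ,
      (λ k → proj₂ (∈-filter⁻ (λ i → f i Fin.≟ e) {xs = allFin M} (∈-lookup k))) ,
      injective⇒≤ {f = code} code-injective
  where
  fibre : Fin p → List (Fin M)
  fibre e = filter (λ i → f i Fin.≟ e) (allFin M)
  ∈-fibre : ∀ i → i List.∈ fibre (f i)
  ∈-fibre i = ∈-filter⁺ (λ j → f j Fin.≟ f i) (∈-allFin i) refl
  position : ∀ i → Fin (length (fibre e))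
  position i = inject≤ (Any.index (∈-fibre i)) (max (f i))
  code : Fin M → Fin (p * length (fibre e))
  code i = combine (f i) (position i)
  -- The fibres of `f i` and `f j` are equal only propositionally, so the comparison of positions is
  -- generalised over both lists.
  index-injective′ : ∀ {xs ys : List (Fin M)} {i j} → xs ≡ ys → (p : i List.∈ xs) (q : j List.∈ ys) →
                     toℕ (Any.index p) ≡ toℕ (Any.index q) → i ≡ j
  index-injective′ refl p q eq = index-injective (setoid _) p q (toℕ-injective eq)
  code-injective : Injective _≡_ _≡_ code
  code-injective {i} {j} eq with combine-injective (f i) (position i) (f j) (position j) eq
  ... | fi≡fj , pos≡ = index-injective′ (cong fibre fi≡fj) (∈-fibre i) (∈-fibre j)
    (trans (sym (Fin.toℕ-inject≤ _ (max (f i)))) (trans (cong toℕ pos≡) (Fin.toℕ-inject≤ _ (max (f j)))))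

-- Division with remainder and congruences modulo p

m/n<o⇒m<o*n : ∀ m n o .{{_ : NonZero n}} → m / n < o → m < o * n
m/n<o⇒m<o*n m n o lt = begin-strict
  m                     ≡⟨ m≡m%n+[m/n]*n m n ⟩
  m % n + m / n * n     <⟨ +-monoˡ-< (m / n * n) (m%n<n m n) ⟩
  suc (m / n) * n       ≤⟨ *-monoˡ-≤ n lt ⟩
  o * n                 ∎
  where open ≤-Reasoning

[q*n+r]/n≡q : ∀ q {n r} .{{_ : NonZero n}} → r < n → (q * n + r) / n ≡ q
[q*n+r]/n≡q q {n} {r} r<n = begin
  (q * n + r) / n     ≡⟨ +-distrib-/-∣ˡ {q * n} r (n∣m*n q) ⟩
  q * n / n + r / n   ≡⟨ cong₂ _+_ (m*n/n≡m q n) (m<n⇒m/n≡0 r<n) ⟩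
  q + 0               ≡⟨ +-identityʳ q ⟩
  q                   ∎
  where open ≡-Reasoning

[q*n+r]%n≡r : ∀ q {n r} .{{_ : NonZero n}} → r < n → (q * n + r) % n ≡ r
[q*n+r]%n≡r q {n} {r} r<n = trans (%-remove-+ˡ r (n∣m*n q)) (m<n⇒m%n≡m r<n)

-- The difference is less than p in absolute value, and 0 is the only such multiple of p.
∣[m-n]⇒≡ : ∀ {p m n} → m < p → n < p → + p ℤ∣.∣ + m ℤ.- + n → m ≡ n
∣[m-n]⇒≡ {p} {m} {n} m<p n<p p∣ = ℤ.+-injective (ℤ.i-j≡0⇒i≡j (+ m) (+ n) (ℤ.∣i∣≡0⇒i≡0 (≡0 _ (∣⇒∣ᵤ p∣) lt)))
  where
  lt : ℤ.∣ + m ℤ.- + n ∣ < p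
  lt = ≤-<-trans (≤-trans (≤-reflexive (cong ℤ.∣_∣ (ℤ.m-n≡m⊖n m n))) (ℤ.∣m⊝n∣≤m⊔n m n)) (⊔-lub m<p n<p)
  ≡0 : ∀ k → p ∣ k → k < p → k ≡ 0
  ≡0 zero    _   _  = refl
  ≡0 (suc k) p∣k lt = contradiction (∣⇒≤ p∣k) (<⇒≱ lt)

∣z-z%p : ∀ z p .{{_ : NonZero p}} → + p ℤ∣.∣ z ℤ.- + (z ℤ.%ℕ p)
∣z-z%p z p = ℤ∣.divides (z ℤ./ℕ p) (trans (cong (ℤ._- + (z ℤ.%ℕ p)) (ℤ.a≡a%ℕn+[a/ℕn]*n z p)) (eq (+ (z ℤ.%ℕ p)) _))
  where
  eq : ∀ r q → r ℤ.+ q ℤ.- r ≡ q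
  eq = ℤ-Ring.solve-∀

euclidsLemma-ℤ : ∀ {p} → Prime p → ∀ a b → + p ℤ∣.∣ a ℤ.* b → (+ p ℤ∣.∣ a) ⊎ (+ p ℤ∣.∣ b)
euclidsLemma-ℤ {p} pr a b h = Sum.map ∣ᵤ⇒∣ ∣ᵤ⇒∣
  (euclidsLemma ℤ.∣ a ∣ ℤ.∣ b ∣ pr (subst (p ∣_) (ℤ.abs-* a b) (∣⇒∣ᵤ h)))

does≡true⇒ : ∀ {A : Set} (A? : Dec A) → does A? ≡ true → A
does≡true⇒ (yes a) _ = a

-- A vertex y + x p stands for the point (x , y); its type is ⌊x / D⌋.
module PointLine (t p D e : ℕ) (p-prime : Prime p) .{{_ : NonZero p}} .{{_ : NonZero D}} (tD≤p : t * D ≤ p)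
                 (n : ℕ) where

  X Y τ : Fin n → ℕ
  X v = toℕ v / p
  Y v = toℕ v % p
  τ v = X v / D

  -- The difference of the two sides of the adjacency congruence, over arbitrary integers so that
  -- linear combinations are left to the ring solver.
  incidence : ℤ → ℤ → ℤ → ℤ → ℤ → ℤ → ℤ
  incidence x y i a b j = x ℤ.* a ℤ.- (y ℤ.+ b ℤ.+ i ℤ.* j ℤ.* + e)

  incidence-sym : ∀ x y i a b j → incidence x y i a b j ≡ incidence a b j x y i
  incidence-sym = lemma (+ e)
    where
    lemma : ∀ e x y i a b j → x ℤ.* a ℤ.- (y ℤ.+ b ℤ.+ i ℤ.* j ℤ.* e) ≡ a ℤ.* x ℤ.- (b ℤ.+ y ℤ.+ j ℤ.* i ℤ.* e)
    lemma = ℤ-Ring.solve-∀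

  Inc : Fin n → Fin n → ℤ
  Inc v w = incidence (+ X v) (+ Y v) (+ τ v) (+ X w) (+ Y w) (+ τ w)

  -- The bounds on types isolate every vertex with `X v` ≥ tD, and so every vertex beyond the p × p
  -- grid.
  Adj : Fin n → Fin n → Set
  Adj v w = v ≢ w × τ v < t × τ w < t × (+ p ℤ∣.∣ Inc v w)

  adj? : ∀ v w → Dec (Adj v w)
  adj? v w = ¬? (v Fin.≟ w) ×-dec (τ v <? t ×-dec (τ w <? t ×-dec (+ p ℤ∣.∣? Inc v w)))

  Adj-sym : ∀ {v w} → Adj v w → Adj w v
  Adj-sym {v} {w} (v≢w , τv , τw , h) = v≢w ∘ sym , τw , τv ,
    subst (+ p ℤ∣.∣_) (incidence-sym (+ X v) (+ Y v) (+ τ v) (+ X w) (+ Y w) (+ τ w)) h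

  graph : Graph n
  graph = record
    { adj    = λ v w → does (adj? v w)
    ; sym    = λ v w → does-⇔ (mk⇔ Adj-sym Adj-sym) (adj? v w) (adj? w v)
    ; irrefl = λ v → dec-false (adj? v v) λ h → proj₁ h refl
    }

  adj⇒Adj : ∀ {v w} → adj graph v w ≡ true → Adj v w
  adj⇒Adj {v} {w} = does≡true⇒ (adj? v w)

  X<p : ∀ {v} → τ v < t → X v < p
  X<p {v} τ<t = <-≤-trans (m/n<o⇒m<o*n (X v) D t τ<t) tD≤p

  vertex-≡ : ∀ {v w} → X v ≡ X w → Y v ≡ Y w → v ≡ w
  vertex-≡ {v} {w} X≡ Y≡ = toℕ-injective (begin
    toℕ v             ≡⟨ m≡m%n+[m/n]*n (toℕ v) p ⟩
    Y v + X v * p     ≡⟨ cong₂ (λ y x → y + x * p) Y≡ X≡ ⟩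
    Y w + X w * p     ≡⟨ m≡m%n+[m/n]*n (toℕ w) p ⟨
    toℕ w             ∎)
    where open ≡-Reasoning

  -- Equal first coordinates give equal types, so the two incidences with w differ only by `Y v` -
  -- `Y u`, and both coordinates are below p.
  sameX⇒≡ : ∀ {u v w} → Adj u w → Adj v w → X u ≡ X v → u ≡ v
  sameX⇒≡ {u} {v} {w} (_ , _ , _ , hu) (_ , _ , _ , hv) X≡ = vertex-≡ X≡ (sym (∣[m-n]⇒≡ (m%n<n _ p) (m%n<n _ p)
    (subst (+ p ℤ∣.∣_) (trans (cong (λ x → incidence (+ X u) (+ Y u) (+ τ u) (+ X w) (+ Y w) (+ τ w) ℤ.-
        incidence (+ x) (+ Y v) (+ (x / D)) (+ X w) (+ Y w) (+ τ w)) (sym X≡))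
        (lemma (+ e) (+ X u) (+ Y u) (+ τ u) (+ X w) (+ Y w) (+ τ w) (+ Y v)))
      (ℤ∣.∣m∣n⇒∣m-n hu hv))))
    where
    lemma : ∀ e x y i a b j y′ →
      x ℤ.* a ℤ.- (y ℤ.+ b ℤ.+ i ℤ.* j ℤ.* e) ℤ.- (x ℤ.* a ℤ.- (y′ ℤ.+ b ℤ.+ i ℤ.* j ℤ.* e)) ≡ y′ ℤ.- y
    lemma = ℤ-Ring.solve-∀

  -- When w and w′ have the same type, the alternating sum of the four incidences loses its e-terms
  -- and collapses to (X u - X v)(X w - X w′). As p is prime, it divides one of the factors.
  noRectangle : ∀ {u v w w′} → Adj u w → Adj v w → Adj u w′ → Adj v w′ → τ w ≡ τ w′ → u ≢ v → w ≡ w′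
  noRectangle {u} {v} {w} {w′} uw@(_ , τu , τw , h₁) vw@(_ , τv , _ , h₂) uw′@(_ , _ , τw′ , h₃) vw′@(_ , _ , _ , h₄) τ≡ u≢v =
    Sum.[ (λ h → contradiction (sameX⇒≡ uw vw (∣[m-n]⇒≡ (X<p τu) (X<p τv) h)) u≢v)
        , (λ h → sameX⇒≡ (Adj-sym uw) (Adj-sym uw′) (∣[m-n]⇒≡ (X<p τw) (X<p τw′) h)) ]′
      (euclidsLemma-ℤ p-prime (+ X u ℤ.- + X v) (+ X w ℤ.- + X w′)
        (subst (+ p ℤ∣.∣_) identity (ℤ∣.∣m∣n⇒∣m-n (ℤ∣.∣m∣n⇒∣m-n h₁ h₂) (ℤ∣.∣m∣n⇒∣m-n h₃ h₄))))
    where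
    lemma : ∀ e x y i x′ y′ i′ a b a′ b′ j →
      (x ℤ.* a ℤ.- (y ℤ.+ b ℤ.+ i ℤ.* j ℤ.* e) ℤ.- (x′ ℤ.* a ℤ.- (y′ ℤ.+ b ℤ.+ i′ ℤ.* j ℤ.* e))) ℤ.-
      (x ℤ.* a′ ℤ.- (y ℤ.+ b′ ℤ.+ i ℤ.* j ℤ.* e) ℤ.- (x′ ℤ.* a′ ℤ.- (y′ ℤ.+ b′ ℤ.+ i′ ℤ.* j ℤ.* e)))
      ≡ (x ℤ.- x′) ℤ.* (a ℤ.- a′)
    lemma = ℤ-Ring.solve-∀
    identity : (Inc u w ℤ.- Inc v w) ℤ.- (Inc u w′ ℤ.- Inc v w′) ≡ (+ X u ℤ.- + X v) ℤ.* (+ X w ℤ.- + X w′)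
    identity = trans
      (cong (λ j → (Inc u w ℤ.- Inc v w) ℤ.- (incidence (+ X u) (+ Y u) (+ τ u) (+ X w′) (+ Y w′) (+ j) ℤ.-
                    incidence (+ X v) (+ Y v) (+ τ v) (+ X w′) (+ Y w′) (+ j))) (sym τ≡))
      (lemma (+ e) (+ X u) (+ Y u) (+ τ u) (+ X v) (+ Y v) (+ τ v) (+ X w) (+ Y w) (+ X w′) (+ Y w′) (+ τ w))

  -- Among `suc t` common neighbours of u and v, two share one of the t types, against
  -- `noRectangle`.
  free : KabFree 2 (suc t) graph
  free (A , B , ∣A∣ , ∣B∣ , _ , com) =
    let u , v , u≢v , u∈A , v∈A = twoElements A (≤-reflexive (sym ∣A∣))
        nb : ∀ {x} → x ∈ A → ∀ k → Adj x (nth B k)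
        nb x∈A k = adj⇒Adj (com _ _ x∈A (nth-∈ B k))
        τ< : ∀ k → τ (nth B k) < t
        τ< k = proj₁ (proj₂ (proj₂ (nb u∈A k)))
        i , j , i<j , τ≡ = pigeonhole (≤-reflexive (sym ∣B∣)) (λ k → fromℕ< (τ< k))
        w≡ = noRectangle (nb u∈A i) (nb v∈A i) (nb u∈A j) (nb v∈A j)
               (trans (sym (toℕ-fromℕ< (τ< i))) (trans (cong toℕ τ≡) (toℕ-fromℕ< (τ< j)))) u≢v
    in <⇒≢ i<j (cong toℕ (nth-injective B w≡))

  -- Copies of K_{t,t}

  module Copies (m : ℕ) (m-small : suc t * (m + m) ≤ D) (2≤t : 2 ≤ t) (p²≤n : p * p ≤ n) where

    point : (i : Fin t) {o : ℕ} → o < D → {y : ℕ} → y < p → Fin n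
    point i {o} o<D {y} y<p = fromℕ< {(toℕ i * D + o) * p + y} (begin-strict
      (toℕ i * D + o) * p + y       <⟨ +-monoʳ-< ((toℕ i * D + o) * p) y<p ⟩
      (toℕ i * D + o) * p + p       ≡⟨ +-comm _ p ⟩
      suc (toℕ i * D + o) * p       ≤⟨ *-monoˡ-≤ p x<p ⟩
      p * p                         ≤⟨ p²≤n ⟩
      n                             ∎)
      where
      open ≤-Reasoning
      x<p : toℕ i * D + o < p
      x<p = begin-strict
        toℕ i * D + o   <⟨ +-monoʳ-< (toℕ i * D) o<D ⟩
        toℕ i * D + D   ≡⟨ +-comm _ D ⟩
        suc (toℕ i) * D ≤⟨ *-monoˡ-≤ D (toℕ<n i) ⟩
        t * D           ≤⟨ tD≤p ⟩
        p               ∎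

    X-point : ∀ i {o} (o<D : o < D) {y} (y<p : y < p) → X (point i o<D y<p) ≡ toℕ i * D + o
    X-point i {o} o<D y<p = trans (cong (_/ p) (toℕ-fromℕ< _)) ([q*n+r]/n≡q (toℕ i * D + o) y<p)

    Y-point : ∀ i {o} (o<D : o < D) {y} (y<p : y < p) → Y (point i o<D y<p) ≡ y
    Y-point i {o} o<D y<p = trans (cong (_% p) (toℕ-fromℕ< _)) ([q*n+r]%n≡r (toℕ i * D + o) y<p)

    τ-point : ∀ i {o} (o<D : o < D) {y} (y<p : y < p) → τ (point i o<D y<p) ≡ toℕ i
    τ-point i o<D y<p = trans (cong (_/ D) (X-point i o<D y<p)) ([q*n+r]/n≡q (toℕ i) o<D)

    -- With δ = D + d, the number x + iδ is iD plus this offset; an offset below D gives it type i.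
    progression<D : ∀ {x d} (i : Fin t) → x < m + m → d < m + m → x + toℕ i * d < D
    progression<D {x} {d} i x< d< = begin-strict
      x + toℕ i * d             <⟨ +-mono-<-≤ x< (*-mono-≤ (<⇒≤ (toℕ<n i)) (<⇒≤ d<)) ⟩
      suc t * (m + m)           ≤⟨ m-small ⟩
      D                         ∎
      where open ≤-Reasoning

    -- The terms at 0 and 1 suffice, and both indices exist because 2 ≤ t.
    progression-injective : ∀ {x d x′ d′} → (∀ (i : Fin t) → x + toℕ i * d ≡ x′ + toℕ i * d′) → x ≡ x′ × d ≡ d′
    progression-injective {x} {d} {x′} {d′} eq with at 0 (<⇒≤ 2≤t) | at 1 2≤t
      where
      at : ∀ k → k < t → x + k * d ≡ x′ + k * d′
      at k k<t = subst (λ k → x + k * d ≡ x′ + k * d′) (toℕ-fromℕ< k<t) (eq (fromℕ< k<t))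
    ... | eq₀ | eq₁ with trans (sym (+-identityʳ x)) (trans eq₀ (+-identityʳ x′))
    ...   | refl = refl , trans (sym (+-identityʳ d)) (trans (+-cancelˡ-≡ x _ _ eq₁) (+-identityʳ d′))

    -- Shifting a and ε by m forces x + iδ < a + iε, so that the two sides of a copy are disjoint.
    shift : Fin m → ℕ
    shift a = m + toℕ a

    shift< : ∀ a → shift a < m + m
    shift< a = +-monoʳ-< m (toℕ<n a)

    small< : ∀ (x : Fin m) → toℕ x < m + m
    small< x = <-≤-trans (toℕ<n x) (m≤m+n m m)

    module _ (x a d d′ : Fin m) (κ : Fin p) where

      -- The second coordinates xa + iδa + κ and jεx - κ before reduction modulo p, where `shift a`
      -- takes the place of a, δ = D + d and ε = D + `shift d′`.
      leftY rightY : Fin t → ℤ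
      leftY  i = + toℕ x ℤ.* + shift a ℤ.+ + toℕ i ℤ.* (+ D ℤ.+ + toℕ d) ℤ.* + shift a ℤ.+ + toℕ κ
      rightY j = + toℕ j ℤ.* (+ D ℤ.+ + shift d′) ℤ.* + toℕ x ℤ.- + toℕ κ

      left-o< : ∀ i → toℕ x + toℕ i * toℕ d < D
      left-o< i = progression<D i (small< x) (small< d)

      right-o< : ∀ j → shift a + toℕ j * shift d′ < D
      right-o< j = progression<D j (shift< a) (shift< d′)

      left-y< : ∀ i → leftY i ℤ.%ℕ p < p
      left-y< i = ℤ.n%ℕd<d (leftY i) p

      right-y< : ∀ j → rightY j ℤ.%ℕ p < p
      right-y< j = ℤ.n%ℕd<d (rightY j) p

      left right : Fin t → Fin n
      left  i = point i (left-o< i) (left-y< i)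
      right j = point j (right-o< j) (right-y< j)

      X-left : ∀ i → X (left i) ≡ toℕ i * D + (toℕ x + toℕ i * toℕ d)
      X-left i = X-point i (left-o< i) (left-y< i)

      X-right : ∀ j → X (right j) ≡ toℕ j * D + (shift a + toℕ j * shift d′)
      X-right j = X-point j (right-o< j) (right-y< j)

      Y-left : ∀ i → Y (left i) ≡ leftY i ℤ.%ℕ p
      Y-left i = Y-point i (left-o< i) (left-y< i)

      Y-right : ∀ j → Y (right j) ≡ rightY j ℤ.%ℕ p
      Y-right j = Y-point j (right-o< j) (right-y< j)

      τ-left : ∀ i → τ (left i) ≡ toℕ i
      τ-left i = τ-point i (left-o< i) (left-y< i)

      τ-right : ∀ j → τ (right j) ≡ toℕ j
      τ-right j = τ-point j (right-o< j) (right-y< j)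

      left-injective : Injective _≡_ _≡_ left
      left-injective {i} {j} eq = toℕ-injective (trans (sym (τ-left i)) (trans (cong τ eq) (τ-left j)))

      right-injective : Injective _≡_ _≡_ right
      right-injective {i} {j} eq = toℕ-injective (trans (sym (τ-right i)) (trans (cong τ eq) (τ-right j)))

      left≢right : ∀ i j → left i ≢ right j
      left≢right i j eq with toℕ-injective (trans (sym (τ-left i)) (trans (cong τ eq) (τ-right j)))
      ... | refl = <⇒≢ lt (+-cancelˡ-≡ (toℕ i * D) _ _ (trans (sym (X-left i)) (trans (cong X eq) (X-right i))))
        where
        lt : toℕ x + toℕ i * toℕ d < shift a + toℕ i * shift d′
        lt = +-mono-<-≤ (<-≤-trans (toℕ<n x) (m≤m+n m _))
               (*-monoʳ-≤ (toℕ i) (≤-trans (<⇒≤ (toℕ<n d)) (m≤m+n m _)))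

      -- The incidence is the sum of the two errors made in reducing `leftY` and `rightY` and of
      -- ij(δε - e); p divides all three.
      left~right : + p ℤ∣.∣ (+ D ℤ.+ + toℕ d) ℤ.* (+ D ℤ.+ + shift d′) ℤ.- + e → ∀ i j → Adj (left i) (right j)
      left~right p∣ i j = left≢right i j , subst (_< t) (sym (τ-left i)) (toℕ<n i) , subst (_< t) (sym (τ-right j)) (toℕ<n j) ,
        subst (+ p ℤ∣.∣_) (sym Inc≡) (ℤ∣.∣m∣n⇒∣m+n (ℤ∣.∣m∣n⇒∣m+n (∣z-z%p (leftY i) p) (∣z-z%p (rightY j) p))
          (ℤ∣.∣n⇒∣m*n (+ toℕ i ℤ.* + toℕ j) p∣))
        where
        lemma : ∀ e D x d a d′ κ i j y b →
          (i ℤ.* D ℤ.+ (x ℤ.+ i ℤ.* d)) ℤ.* (j ℤ.* D ℤ.+ (a ℤ.+ j ℤ.* d′)) ℤ.- (y ℤ.+ b ℤ.+ i ℤ.* j ℤ.* e) ≡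
          (x ℤ.* a ℤ.+ i ℤ.* (D ℤ.+ d) ℤ.* a ℤ.+ κ ℤ.- y) ℤ.+ (j ℤ.* (D ℤ.+ d′) ℤ.* x ℤ.- κ ℤ.- b) ℤ.+
          i ℤ.* j ℤ.* ((D ℤ.+ d) ℤ.* (D ℤ.+ d′) ℤ.- e)
        lemma = ℤ-Ring.solve-∀
        pos-progression : ∀ i x d → + (i * D + (x + i * d)) ≡ + i ℤ.* + D ℤ.+ (+ x ℤ.+ + i ℤ.* + d)
        pos-progression i x d = cong₂ (λ u v → u ℤ.+ (+ x ℤ.+ v)) (ℤ.pos-* i D) (ℤ.pos-* i d)
        y = leftY i ℤ.%ℕ p
        b = rightY j ℤ.%ℕ p
        coordinates : ∀ {x y k a b l x′ y′ k′ a′ b′ l′} → x ≡ x′ → y ≡ y′ → k ≡ k′ → a ≡ a′ → b ≡ b′ → l ≡ l′ →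
                      incidence x y k a b l ≡ incidence x′ y′ k′ a′ b′ l′
        coordinates refl refl refl refl refl refl = refl
        Inc≡ : Inc (left i) (right j) ≡ (leftY i ℤ.- + y) ℤ.+ (rightY j ℤ.- + b) ℤ.+
                 + toℕ i ℤ.* + toℕ j ℤ.* ((+ D ℤ.+ + toℕ d) ℤ.* (+ D ℤ.+ + shift d′) ℤ.- + e)
        Inc≡ = trans
          (coordinates (trans (cong +_ (X-left i)) (pos-progression (toℕ i) (toℕ x) (toℕ d))) (cong +_ (Y-left i)) (cong +_ (τ-left i))
                       (trans (cong +_ (X-right j)) (pos-progression (toℕ j) (shift a) (shift d′))) (cong +_ (Y-right j)) (cong +_ (τ-right j)))
          (lemma (+ e) (+ D) (+ toℕ x) (+ toℕ d) (+ shift a) (+ shift d′) (+ toℕ κ) (+ toℕ i) (+ toℕ j) (+ y) (+ b))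

      copy : Subset n × Subset n
      copy = image left , image right

      copy-isKtt : + p ℤ∣.∣ (+ D ℤ.+ + toℕ d) ℤ.* (+ D ℤ.+ + shift d′) ℤ.- + e → IsKab t t graph (proj₁ copy) (proj₂ copy)
      copy-isKtt p∣ = ∣image∣ left left-injective , ∣image∣ right right-injective , disjoint , complete
        where
        disjoint : Disjoint (image left) (image right)
        disjoint v v∈l v∈r with ∈-image⁻ left v∈l | ∈-image⁻ right v∈r
        ... | i , v≡l | j , v≡r = left≢right i j (trans (sym v≡l) v≡r)
        complete : Complete graph (image left) (image right)
        complete v w v∈ w∈ with ∈-image⁻ left v∈ | ∈-image⁻ right w∈
        ... | i , refl | j , refl = dec-true (adj? (left i) (right j)) (left~right p∣ i j)

    -- The type of a point is its index, so the unordered set already fixes the enumeration.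
    image-determines : (f g : Fin t → Fin n) → (∀ i → τ (f i) ≡ toℕ i) → (∀ i → τ (g i) ≡ toℕ i) →
                       image f ≡ image g → ∀ i → f i ≡ g i
    image-determines f g τf τg eq i with ∈-image⁻ g (subst (f i ∈_) eq (∈-image⁺ f i))
    ... | j , fi≡gj = trans fi≡gj (cong g (toℕ-injective (trans (sym (τg j)) (trans (cong τ (sym fi≡gj)) (τf i)))))

    -- Once x, a and d agree, `leftY` is κ plus a common constant, and κ is below p.
    κ-injective : ∀ {x a d d′ κ x₁ a₁ d₁ d′₁ κ₁} → x ≡ x₁ → a ≡ a₁ → d ≡ d₁ → ∀ i →
                  left x a d d′ κ i ≡ left x₁ a₁ d₁ d′₁ κ₁ i → κ ≡ κ₁
    κ-injective {x} {a} {d} {d′} {κ} {d′₁ = d′₁} {κ₁} refl refl refl i eq =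
      toℕ-injective (∣[m-n]⇒≡ (toℕ<n κ) (toℕ<n κ₁)
        (subst (+ p ℤ∣.∣_) (trans (cong (λ y → leftY x a d d′ κ i ℤ.- + y ℤ.- (leftY x a d d′₁ κ₁ i ℤ.- + y₁)) y≡)
                                  (lemma (+ toℕ x ℤ.* + shift a ℤ.+ + toℕ i ℤ.* (+ D ℤ.+ + toℕ d) ℤ.* + shift a) (+ toℕ κ) (+ toℕ κ₁) (+ y₁)))
          (ℤ∣.∣m∣n⇒∣m-n (∣z-z%p (leftY x a d d′ κ i) p) (∣z-z%p (leftY x a d d′₁ κ₁ i) p))))
      where
      y₁ = leftY x a d d′₁ κ₁ i ℤ.%ℕ p
      y≡ : leftY x a d d′ κ i ℤ.%ℕ p ≡ y₁
      y≡ = trans (sym (Y-left x a d d′ κ i)) (trans (cong Y eq) (Y-left x a d d′₁ κ₁ i))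
      lemma : ∀ c κ κ₁ y → c ℤ.+ κ ℤ.- y ℤ.- (c ℤ.+ κ₁ ℤ.- y) ≡ κ ℤ.- κ₁
      lemma = ℤ-Ring.solve-∀

    -- The first coordinates on the left give x and d, those on the right give a and d′, and a
    -- second coordinate on the left then gives κ.
    copy-injective : ∀ {x a d d′ κ x₁ a₁ d₁ d′₁ κ₁} → copy x a d d′ κ ≡ copy x₁ a₁ d₁ d′₁ κ₁ →
                     x ≡ x₁ × a ≡ a₁ × d ≡ d₁ × d′ ≡ d′₁ × κ ≡ κ₁
    copy-injective {x} {a} {d} {d′} {κ} {x₁} {a₁} {d₁} {d′₁} {κ₁} eq =
      x≡ , a≡ , d≡ , d′≡ , κ-injective {d′ = d′} {d′₁ = d′₁} x≡ a≡ d≡ (fromℕ< 2≤t) (left≡ (fromℕ< 2≤t))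
      where
      left≡ : ∀ i → left x a d d′ κ i ≡ left x₁ a₁ d₁ d′₁ κ₁ i
      left≡ = image-determines _ _ (τ-left x a d d′ κ) (τ-left x₁ a₁ d₁ d′₁ κ₁) (cong proj₁ eq)
      right≡ : ∀ j → right x a d d′ κ j ≡ right x₁ a₁ d₁ d′₁ κ₁ j
      right≡ = image-determines _ _ (τ-right x a d d′ κ) (τ-right x₁ a₁ d₁ d′₁ κ₁) (cong proj₂ eq)
      offsets-left : x ≡ x₁ × d ≡ d₁
      offsets-left = let x= , d= = progression-injective λ i → +-cancelˡ-≡ (toℕ i * D) _ _
                           (trans (sym (X-left x a d d′ κ i)) (trans (cong X (left≡ i)) (X-left x₁ a₁ d₁ d′₁ κ₁ i)))
                     in toℕ-injective x= , toℕ-injective d=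
      offsets-right : a ≡ a₁ × d′ ≡ d′₁
      offsets-right = let a= , d= = progression-injective λ j → +-cancelˡ-≡ (toℕ j * D) _ _
                            (trans (sym (X-right x a d d′ κ j)) (trans (cong X (right≡ j)) (X-right x₁ a₁ d₁ d′₁ κ₁ j)))
                      in toℕ-injective (+-cancelˡ-≡ m _ _ a=) , toℕ-injective (+-cancelˡ-≡ m _ _ d=)
      x≡ = proj₁ offsets-left
      d≡ = proj₂ offsets-left
      a≡ = proj₁ offsets-right
      d′≡ = proj₂ offsets-right

    -- There are m choices for each of x and a, p for κ, and F for the pair (d , d′), listed by
    -- `steps`.
    orderedKtt≥ : ∀ {F} (steps : Fin F → Fin m × Fin m) → Injective _≡_ _≡_ steps →
      (∀ k → + p ℤ∣.∣ (+ D ℤ.+ + toℕ (proj₁ (steps k))) ℤ.* (+ D ℤ.+ + shift (proj₂ (steps k))) ℤ.- + e) →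
      m * (m * (p * F)) ≤ orderedKtt t graph
    orderedKtt≥ {F} steps steps-injective p∣ =
      injection⇒≤length _ (copyOf ∘ Inverse.to enumeration)
        (λ eq → Injection.injective (↔⇒↣ enumeration) (copyOf-injective eq))
        (λ k → ∈-filter⁺ (isKab? t t graph) (∈-cartesianProduct⁺ (∈-allSubsets _) (∈-allSubsets _))
                 (copyOf-isKtt (Inverse.to enumeration k)))
      where
      Parameters = Fin m × Fin m × Fin p × Fin F
      enumeration : Fin (m * (m * (p * F))) ↔ Parameters
      enumeration = ↔-trans Fin.*↔× (↔-refl ×-↔ ↔-trans Fin.*↔× (↔-refl ×-↔ Fin.*↔×))
      copyOf : Parameters → Subset n × Subset n
      copyOf (x , a , κ , k) = copy x a (proj₁ (steps k)) (proj₂ (steps k)) κ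
      copyOf-isKtt : ∀ P → IsKab t t graph (proj₁ (copyOf P)) (proj₂ (copyOf P))
      copyOf-isKtt (x , a , κ , k) = copy-isKtt x a (proj₁ (steps k)) (proj₂ (steps k)) κ (p∣ k)
      copyOf-injective : Injective _≡_ _≡_ copyOf
      copyOf-injective {x , a , κ , k} {x₁ , a₁ , κ₁ , k₁} eq =
        let x≡ , a≡ , d≡ , d′≡ , κ≡ = copy-injective {x} {a} {κ = κ} {x₁} {a₁} {κ₁ = κ₁} eq
        in cong₂ _,_ x≡ (cong₂ _,_ a≡ (cong₂ _,_ κ≡ (steps-injective (cong₂ _,_ d≡ d′≡))))

-- Among the m² products (D + d)(D + m + d′), some residue e mod p occurs at least m²/p times.
denseGraph : ∀ t → 2 ≤ t → ∀ {p m n} → Prime p → 2 ≤ m → t * (suc t * (m + m)) ≤ p → p * p ≤ n →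
             Σ (Graph n) λ G → KabFree 2 (suc t) G × m * (m * (m * m)) ≤ orderedKtt t G
denseGraph t 2≤t {p} {m} {n} p-prime 2≤m tD≤p p²≤n = graph , free ,
  -- The p choices of κ make up for the factor p lost by fixing the residue e.
  ≤-trans (*-monoʳ-≤ m (*-monoʳ-≤ m m²≤pF)) (orderedKtt≥ (remQuot m ∘ g) steps-injective p∣)
  where
  D = suc t * (m + m)
  instance
    p≢0 : NonZero p
    p≢0 = prime⇒nonZero p-prime
    D≢0 : NonZero D
    D≢0 = >-nonZero (≤-trans (s≤s z≤n) (≤-trans 2≤m (≤-trans (m≤m+n m m) (m≤m+n (m + m) _))))
  z : Fin (m * m) → ℤ
  z k = (+ D ℤ.+ + toℕ (proj₁ (remQuot {m} m k))) ℤ.* (+ D ℤ.+ + (m + toℕ (proj₂ (remQuot {m} m k))))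
  residue : Fin (m * m) → Fin p
  residue k = fromℕ< (ℤ.n%ℕd<d (z k) p)
  fibre = largeFibre residue
  e = toℕ (proj₁ fibre)
  F = proj₁ (proj₂ fibre)
  g : Fin F → Fin (m * m)
  g = proj₁ (proj₂ (proj₂ fibre))
  g-injective : Injective _≡_ _≡_ g
  g-injective = proj₁ (proj₂ (proj₂ (proj₂ fibre)))
  residue-g : ∀ k → residue (g k) ≡ proj₁ fibre
  residue-g = proj₁ (proj₂ (proj₂ (proj₂ (proj₂ fibre))))
  m²≤pF : m * m ≤ p * F
  m²≤pF = proj₂ (proj₂ (proj₂ (proj₂ (proj₂ fibre))))
  open PointLine t p D e p-prime tD≤p n
  open Copies m ≤-refl 2≤t p²≤n
  steps-injective : Injective _≡_ _≡_ (remQuot {m} m ∘ g)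
  steps-injective eq = g-injective (Injection.injective (↔⇒↣ (Fin.*↔× {m} {m})) eq)
  p∣ : ∀ k → + p ℤ∣.∣ z (g k) ℤ.- + e
  p∣ k = subst (λ r → + p ℤ∣.∣ z (g k) ℤ.- + r)
    (trans (sym (toℕ-fromℕ< (ℤ.n%ℕd<d (z (g k)) p))) (cong toℕ (residue-g k))) (∣z-z%p (z (g k)) p)

-- From m to n and from ordered pairs to copies

-- Rounding down in the halving loses at most 1, and the quotient, being positive, pays for it once
-- more.
orderedKtt≤3*copiesKtt : ∀ {n} t (G : Graph n) → 2 ≤ orderedKtt t G → orderedKtt t G ≤ 3 * copiesKtt t G
orderedKtt≤3*copiesKtt t G 2≤o = begin
  o                     ≡⟨ m≡m%n+[m/n]*n o 2 ⟩
  o % 2 + o / 2 * 2     ≤⟨ +-mono-≤ (≤-trans (s≤s⁻¹ (m%n<n o 2)) (m≥n⇒m/n>0 2≤o)) (≤-reflexive (*-comm (o / 2) 2)) ⟩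
  3 * (o / 2)           ∎
  where
  open ≤-Reasoning
  o = orderedKtt t G

n²≤ : ∀ K s n p m → n ≤ K * (p * p) → p ≤ s * m → n ^ 2 ≤ K * K * (s * s * (s * s)) * (m * (m * (m * m)))
n²≤ K s n p m n≤ p≤ = begin
  n * (n * 1)                                             ≡⟨ cong (n *_) (*-identityʳ n) ⟩
  n * n                                                   ≤⟨ *-mono-≤ n≤′ n≤′ ⟩
  K * (s * m * (s * m)) * (K * (s * m * (s * m)))         ≡⟨ eq K s m ⟩
  K * K * (s * s * (s * s)) * (m * (m * (m * m)))         ∎
  where
  open ≤-Reasoning
  n≤′ : n ≤ K * (s * m * (s * m))
  n≤′ = ≤-trans n≤ (*-monoʳ-≤ K (*-mono-≤ p≤ p≤))
  eq : ∀ K s m → K * (s * m * (s * m)) * (K * (s * m * (s * m))) ≡ K * K * (s * s * (s * s)) * (m * (m * (m * m)))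
  eq = solve-∀

lowerBound : ∀ t → 2 ≤ t → ∀ K N → (∀ n → N ≤ n → ∃ λ p → Prime p × p * p ≤ n × n ≤ K * (p * p)) →
  ∃ λ q → ∃ λ N′ → ∀ n → N′ ≤ n → Σ (Graph n) λ G → KabFree 2 (suc t) G × n ^ 2 ≤ q * copiesKtt t G
-- The summand N provides the prime; the other gives K s² < n ≤ K p², which forces s ≤ p.
lowerBound t@(suc _) 2≤t K N primes = Q * 3 , N + suc (K * (s * s)) , build
  where
  open ≤-Reasoning
  -- With D = `suc t * (m + m)` one has tD = mc, so m = p / c is the largest choice with tD ≤ p. The
  -- factor 2 in s ensures m ≥ 2.
  c = t * (suc t * 2)
  s = 2 * c
  Q = K * K * (s * s * (s * s))
  build : ∀ n → N + suc (K * (s * s)) ≤ n → Σ (Graph n) λ G → KabFree 2 (suc t) G × n ^ 2 ≤ Q * 3 * copiesKtt t G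
  build n n≥ with primes n (≤-trans (m≤m+n N _) n≥)
  ... | p , p-prime , p²≤n , n≤ = G , proj₁ (proj₂ dense) , (begin
      n ^ 2                           ≤⟨ n²≤ K s n p m n≤ p≤sm ⟩
      Q * (m * (m * (m * m)))         ≤⟨ *-monoʳ-≤ Q (≤-trans m⁴≤o (orderedKtt≤3*copiesKtt t G 2≤o)) ⟩
      Q * (3 * copiesKtt t G)         ≡⟨ *-assoc Q 3 _ ⟨
      Q * 3 * copiesKtt t G           ∎)
    where
    m = p / c
    s≤p : s ≤ p
    s≤p = ≮⇒≥ λ p<s → <⇒≱ (≤-trans (m≤n+m _ N) n≥) (≤-trans n≤ (*-monoʳ-≤ K (*-mono-≤ (<⇒≤ p<s) (<⇒≤ p<s))))
    2≤m : 2 ≤ m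
    2≤m = ≤-trans (≤-reflexive (sym (m*n/n≡m 2 c))) (/-monoˡ-≤ c s≤p)
    eq : ∀ t m → t * (suc t * (m + m)) ≡ m * (t * (suc t * 2))
    eq = solve-∀
    dense = denseGraph t 2≤t {m = m} p-prime 2≤m (≤-trans (≤-reflexive (eq t m)) (m/n*n≤m p c)) p²≤n
    G = proj₁ dense
    m⁴≤o : m * (m * (m * m)) ≤ orderedKtt t G
    m⁴≤o = proj₂ (proj₂ dense)
    1≤m : 1 ≤ m
    1≤m = <⇒≤ 2≤m
    2≤o : 2 ≤ orderedKtt t G
    2≤o = ≤-trans (*-mono-≤ 2≤m (*-mono-≤ 1≤m (*-mono-≤ 1≤m 1≤m))) m⁴≤o
    p≤sm : p ≤ s * m
    p≤sm = begin
      p                 ≤⟨ <⇒≤ (m/n<o⇒m<o*n p c (suc m) ≤-refl) ⟩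
      suc m * c         ≤⟨ *-monoˡ-≤ c (+-monoˡ-≤ m 1≤m) ⟩
      (m + m) * c       ≡⟨ eq′ m c ⟩
      s * m             ∎
      where
      eq′ : ∀ m c → (m + m) * c ≡ 2 * c * m
      eq′ = solve-∀

theorem1p1 : (t : ℕ) → t ≥ 3 →
    Σ ℕ λ p → Σ ℕ λ q → Σ ℕ λ C → Σ ℕ λ N →
    (1 ≤ p) × (1 ≤ q) × (1 ≤ C) ×
    ((n : ℕ) → n ≥ N →
    (Σ (Graph n) λ G → KabFree 2 (suc t) G × (p * n ^ 2 ≤ q * copiesKtt t G))
    × ((G : Graph n) → KabFree 2 (suc t) G → copiesKtt t G ≤ C * n ^ 2))
theorem1p1 t t≥3 = assemble (lowerBound t 2≤t (proj₁ primeNearSqrt) (proj₁ (proj₂ primeNearSqrt)) (proj₂ (proj₂ primeNearSqrt)))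
  where
  2≤t : 2 ≤ t
  2≤t = <⇒≤ t≥3
  n*n≡ : ∀ n → n * n ≡ 1 * (n * (n * 1))
  n*n≡ = solve-∀
  assemble : (∃ λ q → ∃ λ N → ∀ n → N ≤ n → Σ (Graph n) λ G → KabFree 2 (suc t) G × n ^ 2 ≤ q * copiesKtt t G) → _
  -- Taking `suc q` makes the denominator positive and only adds one more `copiesKtt t G` on the
  -- right.
  assemble (q , N , lower) = 1 , suc q , 1 , N , s≤s z≤n , s≤s z≤n , s≤s z≤n , λ n n≥N →
    (let G , free , n²≤ = lower n n≥N
     in G , free , ≤-trans (≤-reflexive (*-identityˡ (n ^ 2))) (≤-trans n²≤ (m≤n+m _ (copiesKtt t G))))
    , λ G free → ≤-trans (copiesKtt≤n² 2≤t G free) (≤-reflexive (n*n≡ n))
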